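{- If a function $f$ is computable by a $T(n)$-time Turing machine, then there is a $(T(n),T(n))$-time TM-TLM that computes $f$.
   Context: A Turing machine with two-level memory (TM-TLM) with main memory size $M$ has three tapes: a main memory tape consisting of exactly $M$ cells, an unbounded external memory tape, and an address tape for the external memory. It has a finite set of states $Q$, an input alphabet $\Sigma$, a tape alphabet $\Gamma\supseteq\Sigma$ containing a blank symbol, a transition function $\delta:Q\times\Gamma\to Q\times\Gamma\times\{L,S,R\}$ acting on the main memory tape, an accepting state, and two distinguished sets of states: Read states and Write states. When the machine enters a Read state, it writes an address $addr$ on the address tape, and the content of the main memory cell under the main memory head is replaced by the content of the external cell at address $addr$. When it enters a Write state, it writes an address $addr$ on the address tape, and the content of the external cell at address $addr$ is replaced by the content of the main memory cell under the head. After a Read/Write operation the head may move left, right, or stay; each Read/Write takes one unit of time. The input resides on the external tape. For a machine $\mathcal{M}$ and input $x$: the time $T_{\mathcal{M}}(x)$ is the number of transitions executed other than Read and Write operations; the IO time $IO_{\mathcal{M}}(x)$ is the number of Read and Write operations executed. $\mathcal{M}$ has time complexity $O(T(n))$ if $T_{\mathcal{M}}(x)=O(T(n))$ for almost all $n$ and all $|x|=n$; IO complexity is defined analogously. A $(T(n),IO(n))$-time TM-TLM is one with time complexity $O(T(n))$ and IO complexity $O(IO(n))$. A $T(n)$-time Turing machine is a classical (deterministic) Turing machine running in time $O(T(n))$. -}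

module Defs where

open import Data.Nat using (ℕ; zero; suc; _+_; _*_; _≤_; _≡ᵇ_)
open import Data.Fin using (Fin; inject₁) renaming (zero to fz; suc to fs)
open import Data.Fin.Properties using () renaming (_≟_ to _≟F_)
open import Data.List using (List; []; _∷_; length)
open import Data.Vec using (Vec; replicate; lookup; _[_]≔_)
open import Data.Product using (Σ; ∃; ∃-syntax; _×_; _,_; proj₁; proj₂)
open import Data.Bool using (if_then_else_)
open import Relation.Nullary using (yes; no)
open import Relation.Binary.PropositionalEquality using (_≡_)

data Move : Set where
  L S R : Move

-- Tape alphabet Γ ⊇ Σ = Fin s: a blank, the input symbols, and e extra symbols.
data Sym (s e : ℕ) : Set where
  blank : Sym s e
  inp   : Fin s → Sym s e
  extra : Fin e → Sym s e

Tape : Set → Set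
Tape A = ℕ → A

update : {A : Set} → Tape A → ℕ → A → Tape A
update t i a j = if i ≡ᵇ j then a else t j

moveℕ : Move → ℕ → ℕ
moveℕ L zero    = zero
moveℕ L (suc n) = n
moveℕ S n       = n
moveℕ R n       = suc n

inputTape : {s e : ℕ} → List (Fin s) → Tape (Sym s e)
inputTape []      i       = blank
inputTape (a ∷ x) zero    = inp a
inputTape (a ∷ x) (suc i) = inputTape x i

HoldsAt : {s e : ℕ} → Tape (Sym s e) → ℕ → List (Fin s) → Set
HoldsAt t k []      = t k ≡ blank
HoldsAt t k (a ∷ y) = (t k ≡ inp a) × HoldsAt t (suc k) y

record TM (s : ℕ) : Set where
  field
    e      : ℕ
    nQ     : ℕ
    δ      : Fin nQ → Sym s e → Fin nQ × Sym s e × Move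
    start  : Fin nQ
    accept : Fin nQ

record TMConfig {s : ℕ} (M : TM s) : Set where
  constructor tmcfg
  field
    state : Fin (TM.nQ M)
    head  : ℕ
    tape  : Tape (Sym s (TM.e M))

tmInit : {s : ℕ} (M : TM s) → List (Fin s) → TMConfig M
tmInit M x = tmcfg (TM.start M) zero (inputTape x)

tmStep : {s : ℕ} (M : TM s) → TMConfig M → TMConfig M
tmStep M (tmcfg q h t) with q ≟F TM.accept M
... | yes _ = tmcfg q h t
... | no _  with TM.δ M q (t h)
...   | q' , a , m = tmcfg q' (moveℕ m h) (update t h a)

tmRun : {s : ℕ} (M : TM s) → ℕ → TMConfig M → TMConfig M
tmRun M zero    c = c
tmRun M (suc n) c = tmRun M n (tmStep M c)

TMComputesInTime : {s : ℕ} → TM s → (List (Fin s) → List (Fin s)) → (ℕ → ℕ) → Set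
TMComputesInTime {s} M f T =
  ∃[ c ] ∃[ N ] ((x : List (Fin s)) → ∃[ t ]
    ( TMConfig.state (tmRun M t (tmInit M x)) ≡ TM.accept M
    × HoldsAt (TMConfig.tape (tmRun M t (tmInit M x))) zero (f x)
    × (N ≤ length x → t ≤ c * T (length x))))

-- Turing machines with two-level memory, main memory size suc m (≥ 1)

data ABit : Set where
  a0 a1 ablank : ABit

readA : List ABit → ℕ → ABit
readA []       _       = ablank
readA (b ∷ bs) zero    = b
readA (b ∷ bs) (suc i) = readA bs i

writeA : List ABit → ℕ → ABit → List ABit
writeA []       zero    b = b ∷ []
writeA []       (suc i) b = ablank ∷ writeA [] i b
writeA (x ∷ xs) zero    b = b ∷ xs
writeA (x ∷ xs) (suc i) b = x ∷ writeA xs i b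

address : List ABit → ℕ
address []           = zero
address (a0 ∷ r)     = 2 * address r
address (a1 ∷ r)     = suc (2 * address r)
address (ablank ∷ r) = zero

moveFin : {m : ℕ} → Move → Fin (suc m) → Fin (suc m)
moveFin L fz                = fz
moveFin {suc m} L (fs i)    = inject₁ i
moveFin S i                 = i
moveFin {zero}  R fz        = fz
moveFin {suc m} R fz        = fs fz
moveFin {suc m} R (fs i)    = fs (moveFin R i)

data Kind : Set where
  ordinary readSt writeSt : Kind

record TLM (s m : ℕ) : Set where
  field
    e      : ℕ
    nQ     : ℕ
    kind   : Fin nQ → Kind
    δ      : Fin nQ → Sym s e → ABit → Fin nQ × Sym s e × Move × ABit × Move
    ioNext : Fin nQ → Fin nQ × Move
    start  : Fin nQ
    accept : Fin nQ

record TLMConfig {s m : ℕ} (P : TLM s m) : Set where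
  constructor tlmcfg
  field
    state : Fin (TLM.nQ P)
    mhead : Fin (suc m)
    mem   : Vec (Sym s (TLM.e P)) (suc m)
    ahead : ℕ
    atape : List ABit
    ext   : Tape (Sym s (TLM.e P))

tlmInit : {s m : ℕ} (P : TLM s m) → List (Fin s) → TLMConfig P
tlmInit P x = tlmcfg (TLM.start P) fz (replicate _ blank) zero [] (inputTape x)

data Cost : Set where
  halted tick io : Cost

tlmStep : {s m : ℕ} (P : TLM s m) → TLMConfig P → TLMConfig P × Cost
tlmStep P (tlmcfg q h mm ah at ex) with q ≟F TLM.accept P
... | yes _ = tlmcfg q h mm ah at ex , halted
... | no _  with TLM.kind P q
...   | readSt  = tlmcfg (proj₁ (TLM.ioNext P q)) (moveFin (proj₂ (TLM.ioNext P q)) h)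
                    (mm [ h ]≔ ex (address at)) ah at ex , io
...   | writeSt = tlmcfg (proj₁ (TLM.ioNext P q)) (moveFin (proj₂ (TLM.ioNext P q)) h)
                    mm ah at (update ex (address at) (lookup mm h)) , io
...   | ordinary with TLM.δ P q (lookup mm h) (readA at ah)
...     | q' , a , mv , b , amv =
          tlmcfg q' (moveFin mv h) (mm [ h ]≔ a) (moveℕ amv ah) (writeA at ah b) ex , tick

tlmRun : {s m : ℕ} (P : TLM s m) → ℕ → TLMConfig P → TLMConfig P × ℕ × ℕ
tlmRun P zero    c = c , zero , zero
tlmRun P (suc n) c with tlmStep P c
... | c' , halted = tlmRun P n c'
... | c' , tick   with tlmRun P n c'
...   | d , t , k = d , suc t , k
tlmRun P (suc n) c | c' , io with tlmRun P n c'
...   | d , t , k = d , t , suc k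

TLMComputesIn : {s m : ℕ} → TLM s m → (List (Fin s) → List (Fin s)) → (ℕ → ℕ) → (ℕ → ℕ) → Set
TLMComputesIn {s} P f T IO =
  ∃[ c ] ∃[ N ] ((x : List (Fin s)) → ∃[ n ]
    ( TLMConfig.state (proj₁ (tlmRun P n (tlmInit P x))) ≡ TLM.accept P
    × HoldsAt (TLMConfig.ext (proj₁ (tlmRun P n (tlmInit P x)))) zero (f x)
    × (N ≤ length x →
         (proj₁ (proj₂ (tlmRun P n (tlmInit P x))) ≤ c * T (length x))
       × (proj₂ (proj₂ (tlmRun P n (tlmInit P x))) ≤ c * IO (length x)))))

{-# OPTIONS --safe #-}

-- Incrementing or decrementing a binary address costs a carry, so a head oscillating around a power of two
-- cannot be followed in the plain address order. Instead the positive addresses are regarded as the nodes of the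
-- infinite binary tree in in-order, with the head of the address tape on the lowest set bit; every step of the
-- Euler tour of this tree changes O(1) bits and moves that head by O(1). The tour meets the nodes in the order
-- 1, 2, 3, … at its in-order visits, but with unbounded gaps: the gap between z − 1 and z is the sum of their heights.
--
-- When cell z of the simulated tape is first needed and is more than four tour steps after cell z − 1, it is moved to
-- the tour position four steps after cell z − 1 (each external symbol has one track per kind of visit). Thus adjacent
-- cells stay within four tour steps. Moving cell z costs its lag pos z − slot z, which follows the recurrence
-- lag z = (lag (z − 1) + gap) ∸ 4; since heights follow the ruler sequence, with average 1, the lags up to p sum to O(p).
-- At the end the moved cells are returned from right to left, at the same cost. The time bound may be 0 only if
-- the start state accepts, a case treated by a machine that halts at once.
module Submission where

open import Defs
open import Data.Nat hiding (parity)
open import Data.Nat.Properties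
open import Data.Nat.Solver using (module +-*-Solver)
open import Data.Bool using (Bool; true; false; if_then_else_)
open import Data.Fin using (Fin; inject₁; toℕ; join; splitAt; combine; remQuot) renaming (zero to fz; suc to fs)
open import Data.Fin.Properties using (toℕ-inject₁; splitAt-join; remQuot-combine) renaming (_≟_ to _≟F_)
open import Data.List using (List; []; _∷_; length)
open import Data.Vec using ([]; _∷_; lookup; _[_]≔_)
open import Data.Unit using (⊤; tt)
open import Data.Product using (∃-syntax; _×_; _,_; proj₁; proj₂)
import Data.Product as Product
open import Data.Sum using (_⊎_; inj₁; inj₂; [_,_]′)
import Data.Sum as Sum
open import Data.Empty using (⊥; ⊥-elim)
open import Function using (_∘_)
open import Relation.Nullary using (yes; no)
open import Relation.Binary.Definitions using (tri<; tri≈; tri>)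
open import Relation.Binary.PropositionalEquality
  using (_≡_; _≢_; _≗_; refl; sym; trans; cong; cong₂; subst; subst₂; module ≡-Reasoning)

-- The tour of the address tree

-- The constant 4 comes from reading the lags as the backlog of a queue. Each height enters two
-- gaps, so the average gap is 2, and a service of 4 per cell drains what the rare tall nodes leave
-- behind. A bounded average gap alone would not bound the sum of the lags: a node of height k
-- leaves a backlog of about 2k, which is felt by order k later cells and costs order k² in all.
-- Such nodes have density 2^-(k+1), so the sum stays linear; this is why it is estimated block by
-- block with a quadratic potential. The machine never computes a slot or a home. Explored cells are
-- recognised by their status, a slot by a counter up to four, and a home as the last in-order visit
-- before the home of the next cell; the latter forces the return from right to left. Cell 1 carries
-- a flag because the bits near the head cannot show that all higher bits are 0, so the left end of
-- the tour would otherwise be invisible.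

odd : ℕ → Bool
odd zero          = false
odd (suc zero)    = true
odd (suc (suc n)) = odd n

half : ℕ → ℕ
half = ⌊_/2⌋

double-suc : ∀ n → 2 * suc n ≡ suc (suc (2 * n))
double-suc n = cong suc (+-suc n (n + 0))

odd-double : ∀ n → odd (2 * n) ≡ false
odd-double zero = refl
odd-double (suc n) = trans (cong odd (double-suc n)) (odd-double n)

odd-suc-double : ∀ n → odd (suc (2 * n)) ≡ true
odd-suc-double zero = refl
odd-suc-double (suc n) = trans (cong (λ k → odd (suc k)) (double-suc n)) (odd-suc-double n)

half-double : ∀ n → half (2 * n) ≡ n
half-double zero = refl
half-double (suc n) = trans (cong half (double-suc n)) (cong suc (half-double n))

half-suc-double : ∀ n → half (suc (2 * n)) ≡ n
half-suc-double zero = refl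
half-suc-double (suc n) = trans (cong (λ k → half (suc k)) (double-suc n)) (cong suc (half-suc-double n))

data Parity : ℕ → Set where
  even-case : ∀ k → Parity (2 * k)
  odd-case  : ∀ k → Parity (suc (2 * k))

parity : ∀ n → Parity n
parity zero = even-case 0
parity (suc n) with parity n
... | even-case k = odd-case k
... | odd-case k  = subst Parity (double-suc k) (even-case (suc k))

double-injective : ∀ m n → 2 * m ≡ 2 * n → m ≡ n
double-injective m n = *-cancelˡ-≡ m n 2

double≢suc-double : ∀ m n → 2 * m ≢ suc (2 * n)
double≢suc-double m n eq with trans (sym (odd-double m)) (trans (cong odd eq) (odd-suc-double n))
... | ()

-- The in-order tree on the positive integers; the head of the address tape rests on bit j of node j w.
node : ℕ → ℕ → ℕ
node zero    w = suc (2 * w)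
node (suc j) w = 2 * node j w

node-injective : ∀ j w j' w' → node j w ≡ node j' w' → j ≡ j' × w ≡ w'
node-injective zero    w zero     w' eq = refl , double-injective w w' (suc-injective eq)
node-injective zero    w (suc j') w' eq = ⊥-elim (double≢suc-double (node j' w') w (sym eq))
node-injective (suc j) w zero     w' eq = ⊥-elim (double≢suc-double (node j w) w' eq)
node-injective (suc j) w (suc j') w' eq with node-injective j w j' w' (double-injective (node j w) (node j' w') eq)
... | refl , refl = refl , refl

node≢0 : ∀ j w → 0 ≢ node j w
node≢0 (suc j) w eq = node≢0 j w (double-injective 0 (node j w) eq)

-- pre j w and post j w are the visits before and after the subtree of the node of height suc j.
data Place : Set where
  origin : Place
  pre inn post : ℕ → ℕ → Place

-- A leaf has only its in-order visit, so entering a subtree of height 0 goes straight to `inn`.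
-- When a subtree is left, the parity of `w` tells which child its root is.
enterR enterL upR upL : ℕ → ℕ → Place
enterR zero    w = inn zero w
enterR (suc j) w = pre j w
enterL zero    w = inn zero w
enterL (suc j) w = post j w
upR j w = if odd w then post j (half w) else inn (suc j) (half w)
upL j w = if odd w then inn (suc j) (half w) else pre j (half w)

stepR stepL : Place → Place
stepR origin          = inn zero zero
stepR (pre j w)       = enterR j (2 * w)
stepR (inn zero w)    = upR zero w
stepR (inn (suc j) w) = enterR j (suc (2 * w))
stepR (post j w)      = upR (suc j) w
stepL origin             = origin
stepL (pre j w)          = upL (suc j) w
stepL (inn zero zero)    = origin
stepL (inn zero (suc w)) = upL zero (suc w)
stepL (inn (suc j) w)    = enterL j (2 * w)
stepL (post j w)         = enterL j (suc (2 * w))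

upR-double : ∀ j w → upR j (2 * w) ≡ inn (suc j) w
upR-double j w rewrite odd-double w | half-double w = refl

upR-suc-double : ∀ j w → upR j (suc (2 * w)) ≡ post j w
upR-suc-double j w rewrite odd-suc-double w | half-suc-double w = refl

upL-double : ∀ j w → upL j (2 * w) ≡ pre j w
upL-double j w rewrite odd-double w | half-double w = refl

upL-suc-double : ∀ j w → upL j (suc (2 * w)) ≡ inn (suc j) w
upL-suc-double j w rewrite odd-suc-double w | half-suc-double w = refl

-- The tree has no root: the nodes `node (suc j) zero` on its left spine are reached only from
-- below, so `pre j zero` is never met. It must be excluded, since `stepL` does not invert `stepR`
-- there: `pre zero zero` leads to `inn zero zero`, whose left neighbour is `origin`.
data OnTour : Place → Set where
  origin : OnTour origin
  pre    : ∀ j w → OnTour (pre j (suc w))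
  inn    : ∀ j w → OnTour (inn j w)
  post   : ∀ j w → OnTour (post j w)

upR-onTour : ∀ j w → OnTour (upR j w)
upR-onTour j w with odd w
... | true  = post j (half w)
... | false = inn (suc j) (half w)

enterR-onTour : ∀ j w → OnTour (enterR j (suc w))
enterR-onTour zero    w = inn zero (suc w)
enterR-onTour (suc j) w = pre j w

stepR-onTour : ∀ {p} → OnTour p → OnTour (stepR p)
stepR-onTour origin        = inn zero zero
stepR-onTour (pre j w)     = enterR-onTour j (w + suc (w + 0))
stepR-onTour (inn zero w)  = upR-onTour zero w
stepR-onTour (inn (suc j) w) = enterR-onTour j (2 * w)
stepR-onTour (post j w)    = upR-onTour (suc j) w

stepL-stepR : ∀ {p} → OnTour p → stepL (stepR p) ≡ p
stepL-stepR origin = refl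
stepL-stepR (pre zero w)    = upL-double zero (suc w)
stepL-stepR (pre (suc j) w) = upL-double (suc j) (suc w)
stepL-stepR (inn zero w) with parity w
... | even-case k rewrite upR-double zero k = refl
... | odd-case k rewrite upR-suc-double zero k = refl
stepL-stepR (inn (suc zero) w) = upL-suc-double zero w
stepL-stepR (inn (suc (suc j)) w) = upL-suc-double (suc j) w
stepL-stepR (post j w) with parity w
... | even-case k rewrite upR-double (suc j) k = refl
... | odd-case k rewrite upR-suc-double (suc j) k = refl

tour : ℕ → Place
tour zero    = origin
tour (suc n) = stepR (tour n)

tour-onTour : ∀ n → OnTour (tour n)
tour-onTour zero    = origin
tour-onTour (suc n) = stepR-onTour (tour-onTour n)

stepL-tour : ∀ n → stepL (tour (suc n)) ≡ tour n
stepL-tour n = stepL-stepR (tour-onTour n)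

stepR≢origin : ∀ {p} → OnTour p → stepR p ≢ origin
stepR≢origin origin ()
stepR≢origin (pre zero w) ()
stepR≢origin (pre (suc j) w) ()
stepR≢origin (inn zero w) eq with odd w
stepR≢origin (inn zero w) () | true
stepR≢origin (inn zero w) () | false
stepR≢origin (inn (suc zero) w) ()
stepR≢origin (inn (suc (suc j)) w) ()
stepR≢origin (post j w) eq with odd w
stepR≢origin (post j w) () | true
stepR≢origin (post j w) () | false

tour-suc≢origin : ∀ n → tour (suc n) ≢ origin
tour-suc≢origin n = stepR≢origin (tour-onTour n)

tour-injective : ∀ m n → tour m ≡ tour n → m ≡ n
tour-injective zero    zero    eq = refl
tour-injective zero    (suc n) eq = ⊥-elim (tour-suc≢origin n (sym eq))
tour-injective (suc m) zero    eq = ⊥-elim (tour-suc≢origin m eq)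
tour-injective (suc m) (suc n) eq = cong suc (tour-injective m n
  (trans (sym (stepL-tour m)) (trans (cong stepL eq) (stepL-tour n))))

tour≢first : ∀ n → tour (suc (suc n)) ≢ inn zero zero
tour≢first n eq with tour-injective (suc (suc n)) 1 eq
... | ()

data Visit : Set where
  atOrigin before within after : Visit

visit : Place → Visit
visit origin     = atOrigin
visit (pre j w)  = before
visit (inn j w)  = within
visit (post j w) = after

location : Place → ℕ
location origin     = zero
location (pre j w)  = node (suc j) w
location (inn j w)  = node j w
location (post j w) = node (suc j) w

place-injective : ∀ p q → visit p ≡ visit q → location p ≡ location q → p ≡ q
place-injective origin     origin       _ _ = refl
place-injective (pre j w)  (pre j' w')  _ e with node-injective (suc j) w (suc j') w' e
... | refl , refl = refl
place-injective (inn j w)  (inn j' w')  _ e with node-injective j w j' w' e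
... | refl , refl = refl
place-injective (post j w) (post j' w') _ e with node-injective (suc j) w (suc j') w' e
... | refl , refl = refl

decompose′ : ∀ fuel n → n ≤ fuel → ∃[ j ] ∃[ w ] suc n ≡ node j w
decompose′ fuel n n≤ with parity n
decompose′ fuel _ n≤ | even-case k = zero , k , refl
decompose′ (suc fuel) _ n≤ | odd-case k
  with decompose′ fuel k (≤-trans (m≤m+n k (k + 0)) (≤-pred n≤))
... | j , w , eq = suc j , w , trans (sym (double-suc k)) (cong (2 *_) eq)

decompose : ∀ n → ∃[ j ] ∃[ w ] suc n ≡ node j w
decompose n = decompose′ n n ≤-refl

-- The value 1 at 0 makes height z + height (suc z) the length of the tour from address z to suc z, for z = 0 too.
height : ℕ → ℕ
height zero    = 1
height (suc n) = proj₁ (decompose n)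

height-node : ∀ j w → height (node j w) ≡ j
height-node j w = go (node j w) refl
  where
  go : ∀ n → n ≡ node j w → height n ≡ j
  go (suc n) eq with decompose n
  ... | j' , w' , eq' = proj₁ (node-injective j' w' j w (trans (sym eq') eq))
  go zero eq = ⊥-elim (node≢0 j w eq)

pos : ℕ → ℕ
pos zero    = zero
pos (suc z) = pos z + (height z + height (suc z))

data Path : Place → ℕ → Place → Set where
  last : ∀ {p q} → stepR p ≡ q → Path p 1 q
  step : ∀ {p q r k} → stepR p ≡ q → visit q ≢ within → Path q k r → Path p (suc k) r

-- Each trailing 1 of `w` is an edge from a right child and yields one `post` visit. The number of
-- trailing ones of `w` is the exponent of 2 in `suc w`.
climb : ∀ t j w u {p} → suc w ≡ node t u → stepR p ≡ upR j w → Path p (suc t) (inn (suc (t + j)) u)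
climb zero j w u eq st rewrite suc-injective eq = last (trans st (upR-double j u))
climb (suc t) j w u {p} eq st with parity w
... | even-case k = ⊥-elim (double≢suc-double (node t u) k (sym eq))
... | odd-case k = subst (λ h → Path p (suc (suc t)) (inn h u)) (cong suc (+-suc t j))
  (step (trans st (upR-suc-double j k)) (λ ()) (climb t (suc j) k u (double-injective (suc k) (node t u) (trans (double-suc k) eq)) refl))

descend : ∀ j w {p} → stepR p ≡ enterR j w → Path p (suc j) (inn zero (2 ^ j * w))
descend zero w st = last (trans st (cong (inn zero) (sym (+-identityʳ w))))
descend (suc j) w {p} st = step st (λ ())
  (subst (λ x → Path (pre j w) (suc j) (inn zero x)) eq (descend j (2 * w) refl))
  where
  eq : 2 ^ j * (2 * w) ≡ 2 * 2 ^ j * w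
  eq = trans (sym (*-assoc (2 ^ j) 2 w)) (cong (_* w) (*-comm (2 ^ j) 2))

node-power : ∀ j w → node j w ≡ 2 ^ j * suc (2 * w)
node-power zero    w = sym (+-identityʳ (suc (2 * w)))
node-power (suc j) w = trans (cong (2 *_) (node-power j w)) (sym (*-assoc 2 (2 ^ j) (suc (2 * w))))

home : ℕ → Place
home zero    = origin
home (suc n) = inn (proj₁ (decompose n)) (proj₁ (proj₂ (decompose n)))

location-home : ∀ z → location (home z) ≡ z
location-home zero    = refl
location-home (suc n) = sym (proj₂ (proj₂ (decompose n)))

home-node : ∀ j w z → z ≡ node j w → home z ≡ inn j w
home-node j w zero    eq = ⊥-elim (node≢0 j w eq)
home-node j w (suc n) eq with decompose n
... | j' , w' , eq' with node-injective j' w' j w (trans (sym eq') eq)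
... | refl , refl = refl

-- Of two consecutive positive addresses one is odd, hence a leaf of height 0. From a leaf the tour
-- climbs to the next address; from an inner node it descends to the leftmost leaf of the right
-- subtree. In both cases the length is the height of the inner node.
home-path : ∀ z → Path (home z) (height z + height (suc z)) (home (suc z))
home-path zero = last refl
home-path (suc n) with decompose n
... | zero , w , eq = subst₂ (Path _) (sym h) (sym hm) (climb t zero w u e refl)
  where
  t = proj₁ (decompose w)
  u = proj₁ (proj₂ (decompose w))
  e : suc w ≡ node t u
  e = proj₂ (proj₂ (decompose w))
  eq′ : suc (suc n) ≡ node (suc t) u
  eq′ = trans (cong suc eq) (trans (sym (double-suc w)) (cong (2 *_) e))
  h : height (suc (suc n)) ≡ suc t
  h = trans (cong height eq′) (height-node (suc t) u)
  hm : home (suc (suc n)) ≡ inn (suc (t + 0)) u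
  hm = trans (home-node (suc t) u _ eq′) (cong (λ x → inn (suc x) u) (sym (+-identityʳ t)))
... | suc j , w , eq = subst₂ (Path _) (sym h) (sym hm) (descend j (suc (2 * w)) refl)
  where
  eq′ : suc (suc n) ≡ node zero (node j w)
  eq′ = cong suc eq
  h : suc j + height (suc (suc n)) ≡ suc j
  h = trans (cong (suc j +_) (trans (cong height eq′) (height-node zero (node j w)))) (+-identityʳ (suc j))
  hm : home (suc (suc n)) ≡ inn zero (2 ^ j * suc (2 * w))
  hm = trans (home-node zero (node j w) _ eq′) (cong (inn zero) (node-power j w))

path-tour : ∀ {k p q} → Path p k q → ∀ n → tour n ≡ p → tour (n + k) ≡ q
path-tour (last e) n t rewrite +-comm n 1 = trans (cong stepR t) e
path-tour (step {k = k} e _ π) n t rewrite +-suc n k = path-tour π (suc n) (trans (cong stepR t) e)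

path-between : ∀ {k p q} → Path p k q → ∀ n → tour n ≡ p →
  ∀ i → n < i → i < n + k → visit (tour i) ≢ within
path-between (last e) n t i n<i i<n rewrite +-comm n 1 = ⊥-elim (<-irrefl refl (<-≤-trans n<i (≤-pred i<n)))
path-between (step {k = k} e v π) n t i n<i i<n with m≤n⇒m<n∨m≡n n<i
... | inj₁ sn<i = path-between π (suc n) (trans (cong stepR t) e) i sn<i (subst (i <_) (+-suc n k) i<n)
... | inj₂ refl = λ eq → v (trans (cong visit (sym (trans (cong stepR t) e))) eq)

tour-pos : ∀ z → tour (pos z) ≡ home z
tour-pos zero    = refl
tour-pos (suc z) = path-tour (home-path z) (pos z) (tour-pos z)

between-homes : ∀ z n → pos z < n → n < pos (suc z) → visit (tour n) ≢ within
between-homes z = path-between (home-path z) (pos z) (tour-pos z)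

path-positive : ∀ {k p q} → Path p k q → 1 ≤ k
path-positive (last _)     = s≤s z≤n
path-positive (step _ _ _) = s≤s z≤n

pos-suc : ∀ z → pos z < pos (suc z)
pos-suc z = subst (_≤ pos (suc z)) (+-comm (pos z) 1) (+-monoʳ-≤ (pos z) (path-positive (home-path z)))

-- The sum of the lags

slot : ℕ → ℕ
slot zero    = zero
slot (suc z) = (slot z + 4) ⊓ pos (suc z)

lag : ℕ → ℕ
lag z = pos z ∸ slot z

slot≤pos : ∀ z → slot z ≤ pos z
slot≤pos zero    = z≤n
slot≤pos (suc z) = m⊓n≤n (slot z + 4) (pos (suc z))

slot+lag : ∀ z → slot z + lag z ≡ pos z
slot+lag z = m+[n∸m]≡n (slot≤pos z)

slot-suc : ∀ z → slot z < slot (suc z)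
slot-suc z = ⊓-glb (subst (_≤ slot z + 4) (+-comm (slot z) 1) (+-monoʳ-≤ (slot z) (s≤s z≤n)))
                   (≤-<-trans (slot≤pos z) (pos-suc z))

slot-step : ∀ z → slot (suc z) ≤ slot z + 4
slot-step z = m⊓n≤m (slot z + 4) (pos (suc z))

-- An upper bound for lag z + height z whose recurrence involves a single height.
load : ℕ → ℕ
load zero    = 1
load (suc z) = 2 * height (suc z) + (load z ∸ 4)

-- Truncated subtraction absorbs the minimum in `slot`. The result is the recurrence for the backlog
-- of a queue with service 4.
lag-recurrence : ∀ z → lag (suc z) ≡ lag z + (height z + height (suc z)) ∸ 4
lag-recurrence z = begin
  pos (suc z) ∸ ((slot z + 4) ⊓ pos (suc z))                ≡⟨ ∸-distribˡ-⊓-⊔ (pos (suc z)) (slot z + 4) (pos (suc z)) ⟩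
  (pos (suc z) ∸ (slot z + 4)) ⊔ (pos (suc z) ∸ pos (suc z)) ≡⟨ cong (pos (suc z) ∸ (slot z + 4) ⊔_) (n∸n≡0 (pos (suc z))) ⟩
  (pos (suc z) ∸ (slot z + 4)) ⊔ 0                          ≡⟨ ⊔-identityʳ _ ⟩
  pos (suc z) ∸ (slot z + 4)                                ≡⟨ sym (∸-+-assoc (pos (suc z)) (slot z) 4) ⟩
  pos z + gap ∸ slot z ∸ 4                                  ≡⟨ cong (_∸ 4) (+-∸-comm gap (slot≤pos z)) ⟩
  lag z + gap ∸ 4                                           ∎
  where
  open ≡-Reasoning
  gap = height z + height (suc z)

-- Pulling `h′` out of the truncated subtraction can only increase the value. It then joins the copy
-- of `h′` kept for the next gap, whence the factor 2 in `load`.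
lag+height≤load : ∀ z → lag z + height z ≤ load z
lag+height≤load zero    = ≤-refl
lag+height≤load (suc z) = begin
  lag (suc z) + h′                 ≡⟨ cong (_+ h′) (lag-recurrence z) ⟩
  lag z + (h + h′) ∸ 4 + h′        ≡⟨ cong (λ x → x ∸ 4 + h′) (sym (+-assoc (lag z) h h′)) ⟩
  lag z + h + h′ ∸ 4 + h′          ≤⟨ +-monoˡ-≤ h′ (∸-monoˡ-≤ 4 (+-monoˡ-≤ h′ (lag+height≤load z))) ⟩
  load z + h′ ∸ 4 + h′             ≡⟨ cong (λ x → x ∸ 4 + h′) (+-comm (load z) h′) ⟩
  h′ + load z ∸ 4 + h′             ≤⟨ +-monoˡ-≤ h′ (m+n∸o≤m+[n∸o] h′ (load z) 4) ⟩
  h′ + (load z ∸ 4) + h′           ≡⟨ +-comm (h′ + (load z ∸ 4)) h′ ⟩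
  h′ + (h′ + (load z ∸ 4))         ≡⟨ sym (+-assoc h′ h′ _) ⟩
  h′ + h′ + (load z ∸ 4)           ≡⟨ cong (λ x → h′ + x + (load z ∸ 4)) (sym (+-identityʳ h′)) ⟩
  2 * h′ + (load z ∸ 4)            ∎
  where
  open ≤-Reasoning
  h = height z
  h′ = height (suc z)
  m+n∸o≤m+[n∸o] : ∀ m n o → m + n ∸ o ≤ m + (n ∸ o)
  m+n∸o≤m+[n∸o] m n zero = ≤-refl
  m+n∸o≤m+[n∸o] m zero (suc o) = m∸n≤m (m + 0) (suc o)
  m+n∸o≤m+[n∸o] m (suc n) (suc o) rewrite +-suc m n = m+n∸o≤m+[n∸o] m n o

total : ℕ → ℕ
total zero    = load zero
total (suc z) = total z + load (suc z)

blockLength : ℕ → ℕ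
blockLength zero    = 0
blockLength (suc k) = blockLength k + suc (blockLength k)

suc-blockLength : ∀ k → suc (blockLength k) ≡ 2 ^ k
suc-blockLength zero    = refl
suc-blockLength (suc k) = begin
  suc (blockLength k) + suc (blockLength k) ≡⟨ cong₂ _+_ (suc-blockLength k) (suc-blockLength k) ⟩
  2 ^ k + 2 ^ k                             ≡⟨ cong (2 ^ k +_) (sym (+-identityʳ (2 ^ k))) ⟩
  2 * 2 ^ k                                 ∎
  where open ≡-Reasoning

-- A block of order `suc k` is two blocks of order `k` around a node of height `k`. The term
-- `10 * k + 4` is what the middle node leaves unpaid in `middle-cost` when the incoming load is
-- below 4 and there is no reserve to draw on.
blockCost : ℕ → ℕ
blockCost zero    = 0
blockCost (suc k) = 2 * blockCost k + 10 * k + 4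

blockCost-closed : ∀ k → blockCost k + 10 * k + 14 ≡ 14 * 2 ^ k
blockCost-closed zero    = refl
blockCost-closed (suc k) = trans
  (solve 2 (λ a j → con 2 :* a :+ con 10 :* j :+ con 4 :+ con 10 :* (con 1 :+ j) :+ con 14
      := con 2 :* (a :+ con 10 :* j :+ con 14)) refl (blockCost k) k)
  (trans (cong (2 *_) (blockCost-closed k))
    (solve 1 (λ p → con 2 :* (con 14 :* p) := con 14 :* (con 2 :* p)) refl (2 ^ k)))
  where open +-*-Solver

square : ℕ → ℕ
square x = x * x

-- The quadratic potential pays for the middle node of a block: its load 2k + (o ∸ 4) is below the offset o + 2k.
middle-cost : ∀ k o o′ → o′ ≤ o ∸ 4 →
  2 * k + (o ∸ 4) + square (2 * k + (o ∸ 4)) + (4 * (o′ + 2 * k) + 4) ≤ square (o + 2 * k) + (10 * k + 4)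
middle-cost k o o′ o′≤ with 4 ≤? o
... | yes 4≤o = begin
  m + square m + (4 * (o′ + 2 * k) + 4)      ≤⟨ +-monoʳ-≤ (m + square m) (+-monoˡ-≤ 4 (*-monoʳ-≤ 4 (+-monoˡ-≤ (2 * k) o′≤))) ⟩
  m + square m + (4 * (o ∸ 4 + 2 * k) + 4)   ≡⟨ cong (λ x → m + square m + (4 * x + 4)) (+-comm (o ∸ 4) (2 * k)) ⟩
  m + square m + (4 * m + 4)                 ≤⟨ m≤m+n _ (3 * m + 12) ⟩
  m + square m + (4 * m + 4) + (3 * m + 12)  ≡⟨ solve 1 (λ x → x :+ x :* x :+ (con 4 :* x :+ con 4) :+ (con 3 :* x :+ con 12)
                                                  := (con 4 :+ x) :* (con 4 :+ x)) refl m ⟩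
  square (4 + m)                             ≡⟨ cong square eq ⟩
  square (o + 2 * k)                         ≤⟨ m≤m+n _ _ ⟩
  square (o + 2 * k) + (10 * k + 4)          ∎
  where
  open ≤-Reasoning
  open +-*-Solver
  m = 2 * k + (o ∸ 4)
  eq : 4 + m ≡ o + 2 * k
  eq = trans (solve 2 (λ a b → con 4 :+ (a :+ b) := con 4 :+ b :+ a) refl (2 * k) (o ∸ 4))
             (cong (_+ 2 * k) (m+[n∸m]≡n 4≤o))
... | no 4≰o rewrite m≤n⇒m∸n≡0 (<⇒≤ (≰⇒> 4≰o)) | n≤0⇒n≡0 o′≤ = begin
  2 * k + 0 + square (2 * k + 0) + (4 * (2 * k) + 4) ≡⟨ solve 1 (λ j → con 2 :* j :+ con 0 :+ (con 2 :* j :+ con 0) :* (con 2 :* j :+ con 0)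
                                                          :+ (con 4 :* (con 2 :* j) :+ con 4)
                                                          := (con 2 :* j) :* (con 2 :* j) :+ (con 10 :* j :+ con 4)) refl k ⟩
  square (2 * k) + (10 * k + 4)                      ≤⟨ +-monoˡ-≤ (10 * k + 4) (*-mono-≤ (m≤n+m (2 * k) o) (m≤n+m (2 * k) o)) ⟩
  square (o + 2 * k) + (10 * k + 4)                  ∎
  where
  open ≤-Reasoning
  open +-*-Solver

-- The square left over by the first half pays three things: the load of the middle node, the square
-- with which the second half starts, and `4 * (o′ + 2 * k) + 4`, the growth of the final square
-- when `k` becomes `suc k`.
combine-costs : ∀ k o o′ a s₀ s₁ s₂ r → o′ ≤ o ∸ 4 →
  s₁ + square (o + 2 * k) ≤ s₀ + r + a →
  s₂ + square (o′ + 2 * k) ≤ s₁ + (2 * k + (o ∸ 4)) + square (2 * k + (o ∸ 4)) + a →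
  s₂ + square (o′ + 2 * suc k) ≤ s₀ + r + (2 * a + 10 * k + 4)
combine-costs k o o′ a s₀ s₁ s₂ r o′≤ h₁ h₂ = begin
  s₂ + square (o′ + 2 * suc k)
    ≡⟨ solve 3 (λ s x j → s :+ (x :+ con 2 :* (con 1 :+ j)) :* (x :+ con 2 :* (con 1 :+ j))
        := s :+ (x :+ con 2 :* j) :* (x :+ con 2 :* j) :+ (con 4 :* (x :+ con 2 :* j) :+ con 4)) refl s₂ o′ k ⟩
  s₂ + square (o′ + 2 * k) + c                     ≤⟨ +-monoˡ-≤ c h₂ ⟩
  s₁ + m + square m + a + c
    ≡⟨ solve 5 (λ s x y b d → s :+ x :+ y :+ b :+ d := s :+ (x :+ y :+ d) :+ b) refl s₁ m (square m) a c ⟩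
  s₁ + (m + square m + c) + a                      ≤⟨ +-monoˡ-≤ a (+-monoʳ-≤ s₁ (middle-cost k o o′ o′≤)) ⟩
  s₁ + (square (o + 2 * k) + (10 * k + 4)) + a
    ≡⟨ solve 4 (λ s x y b → s :+ (x :+ y) :+ b := (s :+ x) :+ (y :+ b)) refl s₁ (square (o + 2 * k)) (10 * k + 4) a ⟩
  s₁ + square (o + 2 * k) + (10 * k + 4 + a)       ≤⟨ +-monoˡ-≤ (10 * k + 4 + a) h₁ ⟩
  s₀ + r + a + (10 * k + 4 + a)
    ≡⟨ solve 4 (λ s x b j → s :+ x :+ b :+ (con 10 :* j :+ con 4 :+ b) := s :+ x :+ (con 2 :* b :+ con 10 :* j :+ con 4)) refl s₀ r a k ⟩
  s₀ + r + (2 * a + 10 * k + 4)                    ∎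
  where
  open ≤-Reasoning
  open +-*-Solver
  m = 2 * k + (o ∸ 4)
  c = 4 * (o′ + 2 * k) + 4

-- The heights strictly inside a dyadic block do not depend on `u`, so both halves obey the same
-- estimate. The load falls by the `2 * k` of the first half and by 4 at the middle node, while the
-- second half cancels the `2 * k` which that node adds; the induction needs a fall of only
-- `2 * suc k`. The summand `2 * k` under the final square is the part of the initial load that has
-- been drained.
block : ∀ k m u → m ≡ 2 ^ k * u →
    load (m + blockLength k) ≤ load m ∸ 2 * k
  × total (m + blockLength k) + square (load (m + blockLength k) + 2 * k) ≤ total m + square (load m) + blockCost k
block zero m u eq rewrite +-identityʳ m | +-identityʳ (load m) | +-identityʳ (total m + square (load m)) = ≤-refl , ≤-refl
block (suc k) m u eq = subst (λ e → load e ≤ load m ∸ 2 * suc k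
    × total e + square (load e + 2 * suc k) ≤ total m + square (load m) + blockCost (suc k)) end (out , sums)
  where
  b = blockLength k
  e₁ = m + b
  eq₁ : m ≡ 2 ^ k * (2 * u)
  eq₁ = trans eq (trans (cong (_* u) (*-comm 2 (2 ^ k))) (*-assoc (2 ^ k) 2 u))
  eq₂ : suc e₁ ≡ 2 ^ k * suc (2 * u)
  eq₂ = begin
    suc (m + b)                ≡⟨ sym (+-suc m b) ⟩
    m + suc b                  ≡⟨ cong₂ _+_ eq₁ (suc-blockLength k) ⟩
    2 ^ k * (2 * u) + 2 ^ k    ≡⟨ +-comm _ (2 ^ k) ⟩
    2 ^ k + 2 ^ k * (2 * u)    ≡⟨ sym (*-suc (2 ^ k) (2 * u)) ⟩
    2 ^ k * suc (2 * u)        ∎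
    where open ≡-Reasoning
  h-mid : height (suc e₁) ≡ k
  h-mid = trans (cong height (trans eq₂ (sym (node-power k u)))) (height-node k u)
  l-mid : load (suc e₁) ≡ 2 * k + (load e₁ ∸ 4)
  l-mid = cong (λ h → 2 * h + (load e₁ ∸ 4)) h-mid
  e₂ = suc e₁ + b
  end : e₂ ≡ m + blockLength (suc k)
  end = trans (sym (+-suc e₁ b)) (+-assoc m b (suc b))
  B₁ = block k m (2 * u) eq₁
  B₂ = block k (suc e₁) (suc (2 * u)) eq₂
  o₂≤ : load e₂ ≤ load e₁ ∸ 4
  o₂≤ = ≤-trans (proj₁ B₂) (≤-reflexive (trans (cong (_∸ 2 * k) l-mid) (m+n∸m≡n (2 * k) (load e₁ ∸ 4))))
  out : load e₂ ≤ load m ∸ 2 * suc k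
  out = ≤-trans o₂≤ (≤-trans (∸-monoˡ-≤ 4 (proj₁ B₁)) (≤-trans (≤-reflexive (∸-+-assoc (load m) (2 * k) 4))
    (∸-monoʳ-≤ (load m) (≤-trans (≤-reflexive (trans (double-suc k) (+-comm 2 (2 * k)))) (+-monoʳ-≤ (2 * k) (s≤s (s≤s z≤n)))))))
  sums : total e₂ + square (load e₂ + 2 * suc k) ≤ total m + square (load m) + blockCost (suc k)
  sums = combine-costs k (load e₁) (load e₂) (blockCost k) (total m) (total e₁) (total e₂) (square (load m)) o₂≤
    (proj₂ B₁)
    (subst (λ l → total e₂ + square (load e₂ + 2 * k) ≤ total e₁ + l + square l + blockCost k) l-mid (proj₂ B₂))

total-mono : ∀ {m n} → m ≤ n → total m ≤ total n
total-mono {m} {n} m≤n with m≤n⇒∃[o]m+o≡n m≤n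
... | o , refl = go o
  where
  go : ∀ o → total m ≤ total (m + o)
  go zero rewrite +-identityʳ m = ≤-refl
  go (suc o) rewrite +-suc m o = ≤-trans (go o) (m≤m+n _ _)

power-above : ∀ p → ∃[ k ] suc p < 2 ^ k × 2 ^ k ≤ 2 * suc p
power-above zero = 1 , ≤-refl , ≤-refl
power-above (suc p) with power-above p
... | k , lt , le with m≤n⇒m<n∨m≡n lt
...   | inj₁ lt′  = k , lt′ , ≤-trans le (*-monoʳ-≤ 2 (n≤1+n (suc p)))
...   | inj₂ eq = suc k , lemma , ≤-reflexive (cong (2 *_) (sym eq))
  where
  lemma : suc (suc p) < 2 * 2 ^ k
  lemma = subst (λ x → suc (suc p) < 2 * x) eq (m<m+n (suc (suc p)) (s≤s z≤n))

total-linear : ∀ p → total (suc p) ≤ 30 * suc p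
total-linear p with power-above p
... | k , lt , le = begin
  total (suc p)                ≤⟨ total-mono (≤-pred (subst (suc (suc p) ≤_) (sym (suc-blockLength k)) lt)) ⟩
  total (blockLength k)        ≤⟨ m≤m+n _ _ ⟩
  total (blockLength k) + square (load (blockLength k) + 2 * k) ≤⟨ proj₂ (block k 0 0 (sym (*-zeroʳ (2 ^ k)))) ⟩
  -- The 2 is `total 0 + square (load 0)`; the closed form of `blockCost` is linear in the block
  -- length `2 ^ k`.
  2 + blockCost k              ≤⟨ +-monoʳ-≤ 2 (≤-trans (m≤m+n _ (10 * k)) (≤-trans (m≤m+n _ 14) (≤-reflexive (blockCost-closed k)))) ⟩
  2 + 14 * 2 ^ k               ≤⟨ +-monoʳ-≤ 2 (*-monoʳ-≤ 14 le) ⟩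
  2 + 14 * (2 * suc p)         ≤⟨ m≤m+n _ (2 * p) ⟩
  2 + 14 * (2 * suc p) + 2 * p ≡⟨ solve 1 (λ x → con 2 :+ con 14 :* (con 2 :* (con 1 :+ x)) :+ con 2 :* x := con 30 :* (con 1 :+ x)) refl p ⟩
  30 * suc p                   ∎
  where
  open ≤-Reasoning
  open +-*-Solver

-- The tour index of cell z when the cells up to p have been explored.
slots : ℕ → ℕ → ℕ
slots p z with z ≤? p
... | yes _ = slot z
... | no _  = pos z

slots-explored : ∀ p z → z ≤ p → slots p z ≡ slot z
slots-explored p z z≤p with z ≤? p
... | yes _  = refl
... | no z≰p = ⊥-elim (z≰p z≤p)

slots-fresh : ∀ p z → p < z → slots p z ≡ pos z
slots-fresh p z p<z with z ≤? p
... | yes z≤p = ⊥-elim (<⇒≱ p<z z≤p)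
... | no _    = refl

slots-extend : ∀ p z → z ≢ suc p → slots (suc p) z ≡ slots p z
slots-extend p z z≢ with z ≤? p
... | yes z≤p = slots-explored (suc p) z (m≤n⇒m≤1+n z≤p)
... | no z≰p  = slots-fresh (suc p) z (≤∧≢⇒< (≰⇒> z≰p) (z≢ ∘ sym))

slots-origin : ∀ p → slots p 0 ≡ 0
slots-origin p = slots-explored p 0 z≤n

slots-first : ∀ p → slots p 1 ≡ 1
slots-first zero    = refl
slots-first (suc p) = slots-explored (suc p) 1 (s≤s z≤n)

slots-suc : ∀ p z → slots p z < slots p (suc z)
slots-suc p z with suc z ≤? p
... | yes z<p rewrite slots-explored p z (<⇒≤ z<p) = slot-suc z
... | no z≮p with z ≤? p
...   | yes z≤p = ≤-<-trans (slot≤pos z) (pos-suc z)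
...   | no _    = pos-suc z

slots-mono : ∀ p {y z} → y ≤ z → slots p y ≤ slots p z
slots-mono p {y} {z} y≤z with m≤n⇒∃[o]m+o≡n y≤z
... | o , refl = go o
  where
  go : ∀ o → slots p y ≤ slots p (y + o)
  go zero rewrite +-identityʳ y = ≤-refl
  go (suc o) rewrite +-suc y o = ≤-trans (go o) (<⇒≤ (slots-suc p (y + o)))

slots-strict : ∀ p {y z} → y < z → slots p y < slots p z
slots-strict p y<z = <-≤-trans (slots-suc p _) (slots-mono p y<z)

slots-injective : ∀ p {y z} → slots p y ≡ slots p z → y ≡ z
slots-injective p {y} {z} eq with <-cmp y z
... | tri< y<z _ _ = ⊥-elim (<⇒≢ (slots-strict p y<z) eq)
... | tri≈ _ y≡z _ = y≡z
... | tri> _ _ z<y = ⊥-elim (<⇒≢ (slots-strict p z<y) (sym eq))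

between-slots : ∀ p z n → slots p z < n → n < slots p (suc z) → ∀ y → slots p y ≢ n
between-slots p z n z<n n<z y refl with y ≤? z
... | yes y≤z = <⇒≱ z<n (slots-mono p y≤z)
... | no y≰z  = <⇒≱ n<z (slots-mono p (≰⇒> y≰z))

slots-positive : ∀ p z → 1 ≤ slots p (suc z)
slots-positive p z = ≤-<-trans z≤n (slots-suc p z)

-- Translates between the flag, which belongs to cell number 1, and the condition for stepping to
-- the origin, which concerns tour index 1. They agree because cell 1 is never moved.
≡ᵇ-slots : ∀ p h n → slots p (suc h) ≡ suc n → (suc h ≡ᵇ 1) ≡ (n ≡ᵇ 0)
≡ᵇ-slots p zero    n eq with suc-injective (trans (sym (slots-first p)) eq)
... | refl = refl
≡ᵇ-slots p (suc h) zero eq = ⊥-elim (<⇒≢ (≤-<-trans (slots-positive p h) (slots-suc p (suc h))) (sym eq))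
≡ᵇ-slots p (suc h) (suc n) eq = refl

gap-bound : ∀ z → pos (suc z) ≤ slot z + 4 + lag (suc z)
gap-bound z = ≤-trans (≤-reflexive (sym (slot+lag (suc z)))) (+-monoˡ-≤ (lag (suc z)) (slot-step z))

-- Single steps of a machine with two-level memory

module _ {s m : ℕ} (P : TLM s m) where
  open TLM P

  tlmStep-ordinary : ∀ {q h x i t ext} → q ≢ accept → kind q ≡ ordinary →
    tlmStep P (tlmcfg q h x i t ext) ≡
      (let q′ , a , mv , b , amv = δ q (lookup x h) (readA t i)
       in tlmcfg q′ (moveFin mv h) (x [ h ]≔ a) (moveℕ amv i) (writeA t i b) ext , tick)
  tlmStep-ordinary {q} ne k with q ≟F accept
  ... | yes eq = ⊥-elim (ne eq)
  ... | no _ with kind q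
  tlmStep-ordinary ne refl | no _ | ordinary = refl

  tlmStep-read : ∀ {q h x i t ext} → q ≢ accept → kind q ≡ readSt →
    tlmStep P (tlmcfg q h x i t ext) ≡
      (tlmcfg (proj₁ (ioNext q)) (moveFin (proj₂ (ioNext q)) h) (x [ h ]≔ ext (address t)) i t ext , io)
  tlmStep-read {q} ne k with q ≟F accept
  ... | yes eq = ⊥-elim (ne eq)
  ... | no _ with kind q
  tlmStep-read ne refl | no _ | readSt = refl

  tlmStep-write : ∀ {q h x i t ext} → q ≢ accept → kind q ≡ writeSt →
    tlmStep P (tlmcfg q h x i t ext) ≡
      (tlmcfg (proj₁ (ioNext q)) (moveFin (proj₂ (ioNext q)) h) x i t (update ext (address t) (lookup x h)) , io)
  tlmStep-write {q} ne k with q ≟F accept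
  ... | yes eq = ⊥-elim (ne eq)
  ... | no _ with kind q
  tlmStep-write ne refl | no _ | writeSt = refl

-- The simulating machine

record Finite (A : Set) : Set where
  field
    size       : ℕ
    encode     : A → Fin size
    decode     : Fin size → A
    decode-encode : ∀ a → decode (encode a) ≡ a
open Finite

finite-Fin : ∀ n → Finite (Fin n)
finite-Fin n = record { size = n ; encode = λ i → i ; decode = λ i → i ; decode-encode = λ _ → refl }

finite-⊎ : ∀ {A B} → Finite A → Finite B → Finite (A ⊎ B)
finite-⊎ F G = record
  { size   = size F + size G
  ; encode = join (size F) (size G) ∘ Sum.map (encode F) (encode G)
  ; decode = Sum.map (decode F) (decode G) ∘ splitAt (size F)
  ; decode-encode = λ x → trans (cong (Sum.map (decode F) (decode G)) (splitAt-join (size F) (size G) (Sum.map (encode F) (encode G) x))) (retract x)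
  }
  where
  retract : ∀ x → Sum.map (decode F) (decode G) (Sum.map (encode F) (encode G) x) ≡ x
  retract (inj₁ a) = cong inj₁ (decode-encode F a)
  retract (inj₂ b) = cong inj₂ (decode-encode G b)

finite-× : ∀ {A B} → Finite A → Finite B → Finite (A × B)
finite-× F G = record
  { size   = size F * size G
  ; encode = λ (a , b) → combine (encode F a) (encode G b)
  ; decode = Product.map (decode F) (decode G) ∘ remQuot (size G)
  ; decode-encode = λ (a , b) → trans
      (cong (Product.map (decode F) (decode G)) (remQuot-combine (encode F a) (encode G b)))
      (cong₂ _,_ (decode-encode F a) (decode-encode G b))
  }

finite-retract : ∀ {A B : Set} (f : A → B) (g : B → A) → (∀ a → g (f a) ≡ a) → Finite B → Finite A
finite-retract f g gf F = record
  { size   = size F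
  ; encode = encode F ∘ f
  ; decode = g ∘ decode F
  ; decode-encode = λ a → trans (cong g (decode-encode F (f a))) (gf a)
  }

finite-⊤ : Finite ⊤
finite-⊤ = finite-retract (λ _ → fz) (λ _ → tt) (λ _ → refl) (finite-Fin 1)

finite-Bool : Finite Bool
finite-Bool = finite-retract (λ { false → fz ; true → fs fz }) (λ { fz → false ; (fs _) → true })
  (λ { false → refl ; true → refl }) (finite-Fin 2)

finite-Visit : Finite Visit
finite-Visit = finite-retract
  (λ { atOrigin → fz ; before → fs fz ; within → fs (fs fz) ; after → fs (fs (fs fz)) })
  (λ { fz → atOrigin ; (fs fz) → before ; (fs (fs fz)) → within ; (fs (fs (fs _))) → after })
  (λ { atOrigin → refl ; before → refl ; within → refl ; after → refl }) (finite-Fin 4)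

finite-Sym : ∀ {s e} → Finite (Sym s e)
finite-Sym {s} {e} = finite-retract
  (λ { blank → inj₁ tt ; (inp a) → inj₂ (inj₁ a) ; (extra a) → inj₂ (inj₂ a) })
  (λ { (inj₁ _) → blank ; (inj₂ (inj₁ a)) → inp a ; (inj₂ (inj₂ a)) → extra a })
  (λ { blank → refl ; (inp a) → refl ; (extra a) → refl })
  (finite-⊎ finite-⊤ (finite-⊎ (finite-Fin s) (finite-Fin e)))

-- Tape updates and the binary form of tour places

≡ᵇ-refl : ∀ n → (n ≡ᵇ n) ≡ true
≡ᵇ-refl zero    = refl
≡ᵇ-refl (suc n) = ≡ᵇ-refl n

≢⇒≡ᵇ-false : ∀ m n → m ≢ n → (m ≡ᵇ n) ≡ false
≢⇒≡ᵇ-false zero    zero    ne = ⊥-elim (ne refl)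
≢⇒≡ᵇ-false zero    (suc n) ne = refl
≢⇒≡ᵇ-false (suc m) zero    ne = refl
≢⇒≡ᵇ-false (suc m) (suc n) ne = ≢⇒≡ᵇ-false m n (ne ∘ cong suc)

update-same : ∀ {A : Set} (t : Tape A) i a → update t i a i ≡ a
update-same t i a rewrite ≡ᵇ-refl i = refl

update-other : ∀ {A : Set} (t : Tape A) i a j → i ≢ j → update t i a j ≡ t j
update-other t i a j ne rewrite ≢⇒≡ᵇ-false i j ne = refl

-- A relation rather than a function, since a descent leaves zeros in the high positions and one
-- number then has several lists. Blanks are excluded because `address` stops at the first of them.
data Bits : List ABit → ℕ → Set where
  []  : Bits [] 0
  a0∷ : ∀ {r w} → Bits r w → Bits (a0 ∷ r) (2 * w)
  a1∷ : ∀ {r w} → Bits r w → Bits (a1 ∷ r) (suc (2 * w))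

address-bits : ∀ {r w} → Bits r w → address r ≡ w
address-bits []      = refl
address-bits (a0∷ b) = cong (2 *_) (address-bits b)
address-bits (a1∷ b) = cong (λ w → suc (2 * w)) (address-bits b)

zeros : ℕ → List ABit → List ABit
zeros zero    l = l
zeros (suc n) l = a0 ∷ zeros n l

zeros-shift : ∀ n l → zeros n (a0 ∷ l) ≡ zeros (suc n) l
zeros-shift zero    l = refl
zeros-shift (suc n) l = cong (a0 ∷_) (zeros-shift n l)

readA-zeros : ∀ n l → readA (zeros n l) n ≡ readA l 0
readA-zeros zero    l = refl
readA-zeros (suc n) l = readA-zeros n l

writeA-zeros : ∀ n l b → writeA (zeros n l) n b ≡ zeros n (writeA l 0 b)
writeA-zeros zero    l b = refl
writeA-zeros (suc n) l b = cong (a0 ∷_) (writeA-zeros n l b)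

data AtPlace : Place → ℕ → List ABit → Set where
  origin : ∀ {r} → Bits r 0 → AtPlace origin 0 (a0 ∷ r)
  pre    : ∀ {r} j w → Bits r w → AtPlace (pre j w) (suc j) (zeros (suc j) (a1 ∷ r))
  inn    : ∀ {r} j w → Bits r w → AtPlace (inn j w) j (zeros j (a1 ∷ r))
  post   : ∀ {r} j w → Bits r w → AtPlace (post j w) (suc j) (zeros (suc j) (a1 ∷ r))

address-node : ∀ {r w} j → Bits r w → address (zeros j (a1 ∷ r)) ≡ node j w
address-node zero    b = cong (λ w → suc (2 * w)) (address-bits b)
address-node (suc j) b = cong (2 *_) (address-node j b)

address-place : ∀ {p h t} → AtPlace p h t → address t ≡ location p
address-place (origin b)   = cong (2 *_) (address-bits b)
address-place (pre j w b)  = address-node (suc j) b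
address-place (inn j w b)  = address-node j b
address-place (post j w b) = address-node (suc j) b

rewriteA-place : ∀ {p h t} → AtPlace p h t → writeA t h (readA t h) ≡ t
rewriteA-place (origin b)   = refl
rewriteA-place (pre j w b)  = cong (a0 ∷_) (trans (cong (writeA _ j) (readA-zeros j _)) (writeA-zeros j _ a1))
rewriteA-place (inn j w b)  = trans (cong (writeA _ j) (readA-zeros j _)) (writeA-zeros j _ a1)
rewriteA-place (post j w b) = cong (a0 ∷_) (trans (cong (writeA _ j) (readA-zeros j _)) (writeA-zeros j _ a1))

data Flavour : Set where
  plain visited first : Flavour

data Dir : Set where
  right left stay toOrigin stop : Dir

module Simulation {s : ℕ} (M : TM s) where

  open TM M renaming (e to eM; δ to δM; nQ to nM; start to startM; accept to acceptM)

  Γ : Set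
  Γ = Sym s eM

  -- The flavour first is that of cell 1, the left end of the tour; plain means not written so far.
  data Status : Set where
    empty  : Status
    guest  : Γ → Status
    native : Flavour → Γ → Status

  data Mode : Set where
    exec  : Fin nM → Mode
    scan  : Fin 4 → Fin nM → Mode
    fetch : Fin nM → Mode
    back  : Γ → Fin nM → Mode
    goL   : Fin nM → Mode
    finR  : Fin 4 → Mode
    finL  : Mode
    rest  : Mode
    restR : Γ → Mode
    restL : Γ → Mode

  Cell : Set
  Cell = Status × Status × Status

  get : Visit → Cell → Status
  get atOrigin (i , b , a) = i
  get before   (i , b , a) = b
  get within   (i , b , a) = i
  get after    (i , b , a) = a

  set : Visit → Status → Cell → Cell
  set atOrigin x (i , b , a) = x , b , a
  set before   x (i , b , a) = i , x , a
  set within   x (i , b , a) = x , b , a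
  set after    x (i , b , a) = i , b , x

  get-set : ∀ v x c → get v (set v x c) ≡ x
  get-set atOrigin x c = refl
  get-set before   x c = refl
  get-set within   x c = refl
  get-set after    x c = refl

  finite-Flavour : Finite Flavour
  finite-Flavour = finite-retract
    (λ { plain → fz ; visited → fs fz ; first → fs (fs fz) })
    (λ { fz → plain ; (fs fz) → visited ; (fs (fs _)) → first })
    (λ { plain → refl ; visited → refl ; first → refl }) (finite-Fin 3)

  finite-Status : Finite Status
  finite-Status = finite-retract
    (λ { empty → inj₁ tt ; (guest a) → inj₂ (inj₁ a) ; (native k a) → inj₂ (inj₂ (k , a)) })
    (λ { (inj₁ _) → empty ; (inj₂ (inj₁ a)) → guest a ; (inj₂ (inj₂ (k , a))) → native k a })
    (λ { empty → refl ; (guest a) → refl ; (native k a) → refl })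
    (finite-⊎ finite-⊤ (finite-⊎ finite-Sym (finite-× finite-Flavour finite-Sym)))

  abstract
   finite-Cell : Finite Cell
   finite-Cell = finite-× finite-Status (finite-× finite-Status finite-Status)

  finite-Dir : Finite Dir
  finite-Dir = finite-retract
    (λ { right → fz ; left → fs fz ; stay → fs (fs fz) ; toOrigin → fs (fs (fs fz)) ; stop → fs (fs (fs (fs fz))) })
    (λ { fz → right ; (fs fz) → left ; (fs (fs fz)) → stay ; (fs (fs (fs fz))) → toOrigin ; (fs (fs (fs (fs _)))) → stop })
    (λ { right → refl ; left → refl ; stay → refl ; toOrigin → refl ; stop → refl }) (finite-Fin 5)

  finite-Mode : Finite Mode
  finite-Mode = finite-retract
    (λ { (exec q)   → inj₁ (inj₁ q)
       ; (scan c q) → inj₁ (inj₂ (inj₁ (c , q)))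
       ; (fetch q)  → inj₁ (inj₂ (inj₂ (inj₁ q)))
       ; (back a q) → inj₁ (inj₂ (inj₂ (inj₂ (a , q))))
       ; (goL q)    → inj₂ (inj₁ q)
       ; (finR c)   → inj₂ (inj₂ (inj₁ c))
       ; finL       → inj₂ (inj₂ (inj₂ (inj₁ false)))
       ; rest       → inj₂ (inj₂ (inj₂ (inj₁ true)))
       ; (restR a)  → inj₂ (inj₂ (inj₂ (inj₂ (inj₁ a))))
       ; (restL a)  → inj₂ (inj₂ (inj₂ (inj₂ (inj₂ a)))) })
    (λ { (inj₁ (inj₁ q)) → exec q
       ; (inj₁ (inj₂ (inj₁ (c , q)))) → scan c q
       ; (inj₁ (inj₂ (inj₂ (inj₁ q)))) → fetch q
       ; (inj₁ (inj₂ (inj₂ (inj₂ (a , q))))) → back a q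
       ; (inj₂ (inj₁ q)) → goL q
       ; (inj₂ (inj₂ (inj₁ c))) → finR c
       ; (inj₂ (inj₂ (inj₂ (inj₁ false)))) → finL
       ; (inj₂ (inj₂ (inj₂ (inj₁ true)))) → rest
       ; (inj₂ (inj₂ (inj₂ (inj₂ (inj₁ a))))) → restR a
       ; (inj₂ (inj₂ (inj₂ (inj₂ (inj₂ a))))) → restL a })
    (λ { (exec q) → refl ; (scan c q) → refl ; (fetch q) → refl ; (back a q) → refl ; (goL q) → refl
       ; (finR c) → refl ; finL → refl ; rest → refl ; (restR a) → refl ; (restL a) → refl })
    (finite-⊎ (finite-⊎ Q (finite-⊎ (finite-× (finite-Fin 4) Q) (finite-⊎ Q (finite-× finite-Sym Q))))
      (finite-⊎ Q (finite-⊎ (finite-Fin 4) (finite-⊎ finite-Bool (finite-⊎ finite-Sym finite-Sym)))))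
    where
    Q : Finite (Fin nM)
    Q = finite-Fin nM

  -- In at/wr/rd the address is complete; the other states edit it. The Bool is true for moves to the right;
  -- child x enters the right child if x is true.
  data Micro : Set where
    at rd              : Visit → Micro
    wr                 : Dir → Visit → Micro
    probe probed       : Bool → Micro
    child              : Bool → Bool → Micro
    entering entered   : Bool → Micro
    climbing climbed   : Bool → Micro
    leaveOrigin enterOrigin halt : Micro
    init₀ init₁ init₂ init₃      : Micro

  finite-Micro : Finite Micro
  finite-Micro = finite-retract
    (λ { (at v) → inj₁ (inj₁ (inj₁ v))
       ; (rd v) → inj₁ (inj₁ (inj₂ v))
       ; (wr d v) → inj₁ (inj₂ (d , v))
       ; (probe d) → inj₂ (inj₁ (fz , d))
       ; (probed d) → inj₂ (inj₁ (fs fz , d))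
       ; (entering d) → inj₂ (inj₁ (fs (fs fz) , d))
       ; (entered d) → inj₂ (inj₁ (fs (fs (fs fz)) , d))
       ; (climbing d) → inj₂ (inj₁ (fs (fs (fs (fs fz))) , d))
       ; (climbed d) → inj₂ (inj₁ (fs (fs (fs (fs (fs fz)))) , d))
       ; (child x d) → inj₂ (inj₂ (inj₁ (x , d)))
       ; leaveOrigin → inj₂ (inj₂ (inj₂ fz))
       ; enterOrigin → inj₂ (inj₂ (inj₂ (fs fz)))
       ; halt → inj₂ (inj₂ (inj₂ (fs (fs fz))))
       ; init₀ → inj₂ (inj₂ (inj₂ (fs (fs (fs fz)))))
       ; init₁ → inj₂ (inj₂ (inj₂ (fs (fs (fs (fs fz))))))
       ; init₂ → inj₂ (inj₂ (inj₂ (fs (fs (fs (fs (fs fz)))))))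
       ; init₃ → inj₂ (inj₂ (inj₂ (fs (fs (fs (fs (fs (fs fz)))))))) })
    (λ { (inj₁ (inj₁ (inj₁ v))) → at v
       ; (inj₁ (inj₁ (inj₂ v))) → rd v
       ; (inj₁ (inj₂ (d , v))) → wr d v
       ; (inj₂ (inj₁ (fz , d))) → probe d
       ; (inj₂ (inj₁ (fs fz , d))) → probed d
       ; (inj₂ (inj₁ (fs (fs fz) , d))) → entering d
       ; (inj₂ (inj₁ (fs (fs (fs fz)) , d))) → entered d
       ; (inj₂ (inj₁ (fs (fs (fs (fs fz))) , d))) → climbing d
       ; (inj₂ (inj₁ (fs (fs (fs (fs (fs _)))) , d))) → climbed d
       ; (inj₂ (inj₂ (inj₁ (x , d)))) → child x d
       ; (inj₂ (inj₂ (inj₂ fz))) → leaveOrigin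
       ; (inj₂ (inj₂ (inj₂ (fs fz)))) → enterOrigin
       ; (inj₂ (inj₂ (inj₂ (fs (fs fz))))) → halt
       ; (inj₂ (inj₂ (inj₂ (fs (fs (fs fz)))))) → init₀
       ; (inj₂ (inj₂ (inj₂ (fs (fs (fs (fs fz))))))) → init₁
       ; (inj₂ (inj₂ (inj₂ (fs (fs (fs (fs (fs fz)))))))) → init₂
       ; (inj₂ (inj₂ (inj₂ (fs (fs (fs (fs (fs (fs _))))))))) → init₃ })
    (λ { (at v) → refl ; (rd v) → refl ; (wr d v) → refl ; (probe d) → refl ; (probed d) → refl
       ; (entering d) → refl ; (entered d) → refl ; (climbing d) → refl ; (climbed d) → refl ; (child x d) → refl
       ; leaveOrigin → refl ; enterOrigin → refl ; halt → refl
       ; init₀ → refl ; init₁ → refl ; init₂ → refl ; init₃ → refl })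
    (finite-⊎ (finite-⊎ (finite-⊎ finite-Visit finite-Visit) (finite-× finite-Dir finite-Visit))
      (finite-⊎ (finite-× (finite-Fin 6) finite-Bool) (finite-⊎ (finite-× finite-Bool finite-Bool) (finite-Fin 7))))

  State : Set
  State = Micro × Mode

  abstract
   finite-State : Finite State
   finite-State = finite-× finite-Micro finite-Mode

  Symbol : Set
  Symbol = Sym s (size finite-Cell)

  -- An unwritten input symbol or blank with empty outer tracks is encoded by itself. Thus the input
  -- tape is already a valid store, and a fully restored store shows the output in the input
  -- alphabet.
  encodeCell : Cell → Symbol
  encodeCell (native plain blank , empty , empty)   = blank
  encodeCell (native plain (inp a) , empty , empty) = inp a
  encodeCell c                                      = extra (encode finite-Cell c)

  decodeCell : Symbol → Cell
  decodeCell blank     = native plain blank , empty , empty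
  decodeCell (inp a)   = native plain (inp a) , empty , empty
  decodeCell (extra i) = decode finite-Cell i

  decode-encodeCell : ∀ c → decodeCell (encodeCell c) ≡ c
  decode-encodeCell c@(empty , _) = decode-encode finite-Cell c
  decode-encodeCell c@(guest _ , _) = decode-encode finite-Cell c
  decode-encodeCell c@(native visited _ , _) = decode-encode finite-Cell c
  decode-encodeCell c@(native first _ , _) = decode-encode finite-Cell c
  decode-encodeCell c@(native plain (extra _) , _) = decode-encode finite-Cell c
  decode-encodeCell (native plain blank , empty , empty) = refl
  decode-encodeCell c@(native plain blank , empty , guest _) = decode-encode finite-Cell c
  decode-encodeCell c@(native plain blank , empty , native _ _) = decode-encode finite-Cell c
  decode-encodeCell c@(native plain blank , guest _ , _) = decode-encode finite-Cell c
  decode-encodeCell c@(native plain blank , native _ _ , _) = decode-encode finite-Cell c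
  decode-encodeCell (native plain (inp _) , empty , empty) = refl
  decode-encodeCell c@(native plain (inp _) , empty , guest _) = decode-encode finite-Cell c
  decode-encodeCell c@(native plain (inp _) , empty , native _ _) = decode-encode finite-Cell c
  decode-encodeCell c@(native plain (inp _) , guest _ , _) = decode-encode finite-Cell c
  decode-encodeCell c@(native plain (inp _) , native _ _ , _) = decode-encode finite-Cell c

  isFirst : Status → Bool
  isFirst (native first _) = true
  isFirst _                = false

  setContent : Status → Γ → Status
  setContent empty              a = empty
  setContent (guest _)          a = guest a
  setContent (native plain _)   a = native visited a
  setContent (native visited _) a = native visited a
  setContent (native first _)   a = native first a

  content : Status → Γ
  content empty        = blank
  content (guest a)    = a
  content (native _ a) = a

  Action : Set
  Action = Status × Dir × Mode

  shift : Move → Visit → Fin nM → Dir × Mode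
  shift L atOrigin q = stay , exec q
  shift L _        q = left , goL q
  shift S _        q = stay , exec q
  -- The move made here is the first of the four tour steps, so the counter reaches `fz` exactly on
  -- the fourth.
  shift R _        q = right , scan (fs (fs (fs fz))) q

  -- fetch and back carry the next native cell to the end of a gap of four; restR and restL return it.
  act : Mode → Visit → Status → Action
  act (exec q) v x with q ≟F acceptM
  ... | yes _ = x , right , finR (fs (fs (fs fz)))
  ... | no _  with δM q (content x)
  ...   | q′ , a , mv = setContent x a , shift mv v q′
  act (scan fz q)     v empty = guest blank , right , fetch q
  act (scan (fs c) q) v empty = empty , right , scan (inject₁ c) q
  act (scan _ q)      v x     = x , stay , exec q
  act (fetch q)  v empty = empty , right , fetch q
  act (fetch q)  v x     = empty , left , back (content x) q
  act (back a q) v empty = empty , left , back a q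
  act (back a q) v x     = guest a , stay , exec q
  act (goL q)    v empty = empty , left , goL q
  act (goL q)    v x     = x , stay , exec q
  act (finR c)      v x@(native plain _) = x , left , finL
  act (finR fz)     v empty = empty , left , finL
  act (finR (fs c)) v empty = empty , right , finR (inject₁ c)
  act (finR _)      v x     = x , right , finR (fs (fs (fs fz)))
  act finL       v empty = empty , left , finL
  act finL       v x     = x , stay , rest
  act rest atOrigin x            = native plain (content x) , stop , rest
  act rest v        empty        = empty , left , rest
  act rest v        (guest a)    = empty , right , restR a
  act rest v        (native _ a) = native plain a , left , finL
  act (restR a) v      empty = empty , right , restR a
  act (restR a) v      x     = x , left , restL a
  act (restL a) within x     = native plain a , left , finL
  act (restL a) v      x     = x , left , restL a

  -- The flagged cell 1 rests at `inn zero zero`, an in-order visit. Without the flag the local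
  -- moves would lead from there to `pre zero zero`, which is off the tour, instead of to the
  -- origin.
  turn : Dir → Visit → Status → Dir
  turn left within x = if isFirst x then toOrigin else left
  turn d    v      x = d

  afterWrite : Dir → Visit → Micro
  afterWrite right    atOrigin = leaveOrigin
  afterWrite right    before   = child false true
  afterWrite right    within   = probe true
  afterWrite right    after    = climbing true
  afterWrite left     atOrigin = halt
  afterWrite left     before   = climbing false
  afterWrite left     within   = probe false
  afterWrite left     after    = child true false
  afterWrite stay     v        = at v
  afterWrite toOrigin v        = enterOrigin
  afterWrite stop     v        = halt

  kindOf : Micro → Kind
  kindOf (rd _)   = readSt
  kindOf (wr _ _) = writeSt
  kindOf init₁    = readSt
  kindOf init₃    = writeSt
  kindOf _        = ordinary

  ioNextOf : Micro → Micro
  ioNextOf (rd v)   = at v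
  ioNextOf (wr d v) = afterWrite d v
  ioNextOf init₁    = init₂
  ioNextOf init₃    = enterOrigin
  ioNextOf u        = u

  isOne : ABit → Bool
  isOne a1 = true
  isOne _  = false

  bit : Bool → ABit
  bit true  = a1
  bit false = a0

  mark : Status → Status
  mark (native _ a) = native first a
  mark x            = x

  Output : Set
  Output = State × Cell × ABit × Move

  transition : State → Cell → ABit → Output
  transition (at v , m) c b =
    let x , d , m′ = act m v (get v c) in
    (wr (turn d v (get v c)) v , m′) , set v x c , b , S
  transition (probe d , m) c b = (probed d , m) , c , b , L
  transition (probed d , m) c b =
    if isOne b then ((climbed d , m) , c , a0 , R) else ((child d d , m) , c , b , R)
  transition (child x d , m) c b = (entering d , m) , c , bit x , L
  transition (entering d , m) c b = (entered d , m) , c , a1 , L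
  transition (entered d , m) c b =
    if isOne b then ((rd within , m) , c , b , S)
    else ((rd (if d then before else after) , m) , c , b , R)
  -- Clearing the lowest set bit and setting the next one gives the parent. The old value of that
  -- next bit tells whether a right child was left, hence which visit of the parent follows.
  transition (climbing d , m) c b = (climbed d , m) , c , a0 , R
  transition (climbed d , m) c b =
    (rd (if d then (if isOne b then after else within) else (if isOne b then within else before)) , m) , c , a1 , S
  transition (leaveOrigin , m) c b = (rd within , m) , c , a1 , S
  transition (enterOrigin , m) c b = (rd atOrigin , m) , c , a0 , S
  -- A single 1 on the empty address tape addresses cell 1, which receives its flag; `enterOrigin`
  -- then clears this bit to reach cell 0.
  transition (init₀ , m) c b = (init₁ , m) , c , a1 , S
  transition (init₂ , m) c b = (init₃ , m) , set within (mark (get within c)) c , b , S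
  transition (u , m) c b = (u , m) , c , b , S

  code : State → Fin (size finite-State)
  code = encode finite-State

  uncode : Fin (size finite-State) → State
  uncode = decode finite-State

  P : TLM s 0
  P = record
    { e      = size finite-Cell
    ; nQ     = size finite-State
    ; kind   = λ q → kindOf (proj₁ (uncode q))
    ; δ      = λ q x b → let st , c , b′ , mv = transition (uncode q) (decodeCell x) b
                         in code st , encodeCell c , S , b′ , mv
    ; ioNext = λ q → code (Product.map₁ ioNextOf (uncode q)) , S
    ; start  = code (init₀ , exec startM)
    ; accept = code (halt , rest)
    }

  -- Bounded reachability between configurations

  Config : Set
  Config = TLMConfig P

  config : State → Symbol → ℕ → List ABit → Tape Symbol → Config
  config st x h t ext = tlmcfg (code st) fz (x ∷ []) h t ext

  data Reach : Config → ℕ → Config → Set where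
    done : ∀ {c n} → Reach c n c
    step : ∀ {c c₁ c₂ k n} → k ≢ halted → tlmStep P c ≡ (c₁ , k) → Reach c₁ n c₂ → Reach c (suc n) c₂

  reach-weaken : ∀ {c c′ m n} → m ≤ n → Reach c m c′ → Reach c n c′
  reach-weaken m≤n       done         = done
  reach-weaken (s≤s m≤n) (step k e r) = step k e (reach-weaken m≤n r)

  reach-trans : ∀ {c₁ c₂ c₃ m n} → Reach c₁ m c₂ → Reach c₂ n c₃ → Reach c₁ (m + n) c₃
  reach-trans {m = m} {n} done r = reach-weaken (m≤n+m n m) r
  reach-trans (step k e r) r′ = step k e (reach-trans r r′)

  code≢accept : ∀ {u m} → u ≢ halt → code (u , m) ≢ TLM.accept P
  code≢accept {u} {m} ne eq = ne (cong proj₁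
    (trans (sym (decode-encode finite-State (u , m))) (trans (cong uncode eq) (decode-encode finite-State (halt , rest)))))

  kind-code : ∀ u m {k} → kindOf u ≡ k → TLM.kind P (code (u , m)) ≡ k
  kind-code u m = trans (cong (kindOf ∘ proj₁) (decode-encode finite-State (u , m)))

  tick-step : ∀ {u m x h t ext n c} → u ≢ halt → kindOf u ≡ ordinary →
    let st , y , b , mv = transition (u , m) (decodeCell x) (readA t h) in
    Reach (config st (encodeCell y) (moveℕ mv h) (writeA t h b) ext) n c →
    Reach (config (u , m) x h t ext) (suc n) c
  tick-step {u} {m} {x} {h} {t} {ext} ne ku = step (λ ()) (trans
    (tlmStep-ordinary P (code≢accept ne) (kind-code u m ku))
    (cong (λ st → let st , y , b , mv = transition st (decodeCell x) (readA t h)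
                  in config st (encodeCell y) (moveℕ mv h) (writeA t h b) ext , tick)
      (decode-encode finite-State (u , m))))

  read-step : ∀ {u m x h t ext n c} → u ≢ halt → kindOf u ≡ readSt →
    Reach (config (ioNextOf u , m) (ext (address t)) h t ext) n c → Reach (config (u , m) x h t ext) (suc n) c
  read-step {u} {m} {x} {h} {t} {ext} ne ku = step (λ ()) (trans
    (tlmStep-read P (code≢accept ne) (kind-code u m ku))
    (cong (λ st → config (Product.map₁ ioNextOf st) (ext (address t)) h t ext , io) (decode-encode finite-State (u , m))))

  write-step : ∀ {u m x h t ext n c} → u ≢ halt → kindOf u ≡ writeSt →
    Reach (config (ioNextOf u , m) x h t (update ext (address t) x)) n c → Reach (config (u , m) x h t ext) (suc n) c
  write-step {u} {m} {x} {h} {t} {ext} ne ku = step (λ ()) (trans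
    (tlmStep-write P (code≢accept ne) (kind-code u m ku))
    (cong (λ st → config (Product.map₁ ioNextOf st) x h t (update ext (address t) x) , io) (decode-encode finite-State (u , m))))

  tick-to : ∀ {u m x h t ext n c b st y b′ mv t′} → u ≢ halt → kindOf u ≡ ordinary → readA t h ≡ b →
    transition (u , m) (decodeCell x) b ≡ (st , y , b′ , mv) → writeA t h b′ ≡ t′ →
    Reach (config st (encodeCell y) (moveℕ mv h) t′ ext) n c → Reach (config (u , m) x h t ext) (suc n) c
  tick-to ne ku refl eq refl r = tick-step ne ku (subst
    (λ (st , y , b′ , mv) → Reach (config st (encodeCell y) (moveℕ mv _) (writeA _ _ b′) _) _ _) (sym eq) r)

  -- One tour step on the address tape

  module _ (m : Mode) (ext : Tape Symbol) where

    Moved : Micro → Symbol → ℕ → List ABit → ℕ → Place → Set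
    Moved u x h t k p = ∃[ x′ ] ∃[ h′ ] ∃[ t′ ]
      Reach (config (u , m) x h t ext) k (config (rd (visit p) , m) x′ h′ t′ ext) × AtPlace p h′ t′

    first-tick : ∀ {u u′ x h h′ t k p b b′ y mv t′} → u ≢ halt → kindOf u ≡ ordinary → readA t h ≡ b →
      transition (u , m) (decodeCell x) b ≡ ((u′ , m) , y , b′ , mv) → writeA t h b′ ≡ t′ → moveℕ mv h ≡ h′ →
      Moved u′ (encodeCell y) h′ t′ k p → Moved u x h t (suc k) p
    first-tick ne ku e₁ e₂ e₃ refl (x′ , h′ , t′ , r , a) = x′ , h′ , t′ , tick-to ne ku e₁ e₂ e₃ r , a

    arrived : ∀ {x h t p k} → AtPlace p h t → Moved (rd (visit p)) x h t k p
    arrived a = _ , _ , _ , done , a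

    -- The 1 of the node has just been cleared and the head rests on the lowest bit of `w`. Past the
    -- end of the list a blank is read and counts as 0, which is the case `[]`.
    climbed-right : ∀ {x r w k} j → Bits r w → Moved (climbed true) x (suc j) (zeros (suc j) r) (suc k) (upR j w)
    climbed-right j [] = first-tick (λ ()) refl (readA-zeros j []) refl (cong (a0 ∷_) (writeA-zeros j [] a1)) refl
      (arrived (inn (suc j) 0 []))
    climbed-right {k = k} j (a0∷ {r} {w} b) = subst (Moved _ _ _ _ (suc k)) (sym (upR-double j w))
      (first-tick (λ ()) refl (readA-zeros j _) refl (cong (a0 ∷_) (writeA-zeros j _ a1)) refl (arrived (inn (suc j) w b)))
    climbed-right {k = k} j (a1∷ {r} {w} b) = subst (Moved _ _ _ _ (suc k)) (sym (upR-suc-double j w))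
      (first-tick (λ ()) refl (readA-zeros j _) refl (cong (a0 ∷_) (writeA-zeros j _ a1)) refl (arrived (post j w b)))

    climbed-left : ∀ {x r w k} j → Bits r w → Moved (climbed false) x (suc j) (zeros (suc j) r) (suc k) (upL j w)
    climbed-left j [] = first-tick (λ ()) refl (readA-zeros j []) refl (cong (a0 ∷_) (writeA-zeros j [] a1)) refl
      (arrived (pre j 0 []))
    climbed-left {k = k} j (a0∷ {r} {w} b) = subst (Moved _ _ _ _ (suc k)) (sym (upL-double j w))
      (first-tick (λ ()) refl (readA-zeros j _) refl (cong (a0 ∷_) (writeA-zeros j _ a1)) refl (arrived (pre j w b)))
    climbed-left {k = k} j (a1∷ {r} {w} b) = subst (Moved _ _ _ _ (suc k)) (sym (upL-suc-double j w))
      (first-tick (λ ()) refl (readA-zeros j _) refl (cong (a0 ∷_) (writeA-zeros j _ a1)) refl (arrived (inn (suc j) w b)))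

    climbing-right : ∀ {x r w k} j → Bits r w →
      Moved (climbing true) x (suc j) (zeros (suc j) (a1 ∷ r)) (2 + k) (upR (suc j) w)
    climbing-right j b = first-tick (λ ()) refl refl refl
      (trans (cong (a0 ∷_) (writeA-zeros j _ a0)) (cong (a0 ∷_) (zeros-shift j _))) refl (climbed-right (suc j) b)

    climbing-left : ∀ {x r w k} j → Bits r w →
      Moved (climbing false) x (suc j) (zeros (suc j) (a1 ∷ r)) (2 + k) (upL (suc j) w)
    climbing-left j b = first-tick (λ ()) refl refl refl
      (trans (cong (a0 ∷_) (writeA-zeros j _ a0)) (cong (a0 ∷_) (zeros-shift j _))) refl (climbed-left (suc j) b)

    entering-right : ∀ {x r w k} j → Bits r w → Moved (entering true) x j (zeros j (a0 ∷ r)) (2 + k) (enterR j w)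
    entering-right zero b = first-tick (λ ()) refl refl refl refl refl
      (first-tick (λ ()) refl refl refl refl refl (arrived (inn 0 _ b)))
    entering-right (suc j) b = first-tick (λ ()) refl refl refl (cong (a0 ∷_) (writeA-zeros j _ a1)) refl
      (first-tick (λ ()) refl (trans (cong (λ t → readA t j) (sym (zeros-shift j _))) (readA-zeros j _)) refl
        (trans (cong (λ t → writeA t j a0) (sym (zeros-shift j _))) (trans (writeA-zeros j _ a0) (zeros-shift j _)))
        refl (arrived (pre j _ b)))

    entering-left : ∀ {x r w k} j → Bits r w → Moved (entering false) x j (zeros j (a0 ∷ r)) (2 + k) (enterL j w)
    entering-left zero b = first-tick (λ ()) refl refl refl refl refl
      (first-tick (λ ()) refl refl refl refl refl (arrived (inn 0 _ b)))
    entering-left (suc j) b = first-tick (λ ()) refl refl refl (cong (a0 ∷_) (writeA-zeros j _ a1)) refl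
      (first-tick (λ ()) refl (trans (cong (λ t → readA t j) (sym (zeros-shift j _))) (readA-zeros j _)) refl
        (trans (cong (λ t → writeA t j a0) (sym (zeros-shift j _))) (trans (writeA-zeros j _ a0) (zeros-shift j _)))
        refl (arrived (post j _ b)))

    child-tick : ∀ {x r k p} b d j →
      (∀ {x} → Moved (entering d) x j (zeros j (a0 ∷ bit b ∷ r)) k p) →
      Moved (child b d) x (suc j) (zeros (suc j) (a1 ∷ r)) (suc k) p
    child-tick b d j rec = first-tick (λ ()) refl refl refl
      (trans (cong (a0 ∷_) (writeA-zeros j _ (bit b))) (sym (zeros-shift j _))) refl rec

    -- A move to the left at the left end of the address tape stays there, so a second 1 identifies a leaf.
    probe-leaf : ∀ {x r k p} d → (∀ {x} → Moved (climbed d) x 1 (a0 ∷ r) k p) →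
      Moved (probe d) x 0 (a1 ∷ r) (2 + k) p
    probe-leaf d rec = first-tick (λ ()) refl refl refl refl refl (first-tick (λ ()) refl refl refl refl refl rec)

    probe-inner : ∀ {x r k p} d j → (∀ {x} → Moved (child d d) x (suc j) (zeros (suc j) (a1 ∷ r)) k p) →
      Moved (probe d) x (suc j) (zeros (suc j) (a1 ∷ r)) (2 + k) p
    probe-inner d j rec = first-tick (λ ()) refl (readA-zeros j _) refl (cong (a0 ∷_) (writeA-zeros j _ a1)) refl
      (first-tick (λ ()) refl (trans (cong (λ t → readA t j) (sym (zeros-shift j _))) (readA-zeros j _)) refl
        (trans (cong (λ t → writeA t j a0) (sym (zeros-shift j _))) (trans (writeA-zeros j _ a0) (zeros-shift j _)))
        refl rec)

    -- The bound 5 is attained at inner nodes: two steps of probing, one for the bit that selects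
    -- the child, two for entering it.
    move-right : ∀ {x p h t} → AtPlace p h t → Moved (afterWrite right (visit p)) x h t 5 (stepR p)
    move-right (origin b)        = first-tick (λ ()) refl refl refl refl refl (arrived (inn 0 0 b))
    move-right (pre j w b)       = child-tick false true j (entering-right j (a0∷ b))
    move-right (inn zero w b)    = probe-leaf true (climbed-right 0 b)
    move-right (inn (suc j) w b) = probe-inner true j (child-tick true true j (entering-right j (a1∷ b)))
    move-right (post j w b)      = climbing-right j b

    move-left : ∀ {x p h t} → AtPlace p h t → p ≢ origin → p ≢ inn 0 0 →
      Moved (afterWrite left (visit p)) x h t 5 (stepL p)
    move-left (origin b)           ne _   = ⊥-elim (ne refl)
    move-left (pre j w b)          _ _    = climbing-left j b
    move-left (inn zero zero b)    _ ne   = ⊥-elim (ne refl)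
    move-left (inn zero (suc w) b) _ _    = probe-leaf false (climbed-left 0 b)
    move-left (inn (suc j) w b)    _ _    = probe-inner false j (child-tick false false j (entering-left j (a0∷ b)))
    move-left (post j w b)         _ _    = child-tick true false j (entering-left j (a1∷ b))

    move-toOrigin : ∀ {x h t} → AtPlace (inn 0 0) h t → Moved (afterWrite toOrigin within) x h t 5 origin
    move-toOrigin (inn 0 0 b) = first-tick (λ ()) refl refl refl refl refl (arrived (origin b))

  -- Actions on the tour

  Store : Set
  Store = ℕ → Status

  get-set-other : ∀ v v′ x c → v ≢ v′ → v ≢ atOrigin → v′ ≢ atOrigin → get v (set v′ x c) ≡ get v c
  get-set-other atOrigin v′       x c _ n _ = ⊥-elim (n refl)
  get-set-other v        atOrigin x c _ _ n = ⊥-elim (n refl)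
  get-set-other before   before   x c n _ _ = ⊥-elim (n refl)
  get-set-other before   within   x c _ _ _ = refl
  get-set-other before   after    x c _ _ _ = refl
  get-set-other within   before   x c _ _ _ = refl
  get-set-other within   within   x c n _ _ = ⊥-elim (n refl)
  get-set-other within   after    x c _ _ _ = refl
  get-set-other after    before   x c _ _ _ = refl
  get-set-other after    within   x c _ _ _ = refl
  get-set-other after    after    x c n _ _ = ⊥-elim (n refl)

  visit-origin : ∀ p → visit p ≡ atOrigin → p ≡ origin
  visit-origin origin _ = refl

  location-origin : ∀ p → location p ≡ 0 → p ≡ origin
  location-origin origin     _ = refl
  location-origin (pre j w)  e = ⊥-elim (node≢0 (suc j) w (sym e))
  location-origin (inn j w)  e = ⊥-elim (node≢0 j w (sym e))
  location-origin (post j w) e = ⊥-elim (node≢0 (suc j) w (sym e))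

  -- The origin and the in-order visits share a track, but no conflict arises: `origin` is the only
  -- place with address 0.
  get-set-place : ∀ p q x c → p ≢ q → location p ≡ location q → get (visit p) (set (visit q) x c) ≡ get (visit p) c
  get-set-place p q x c ne loc = get-set-other (visit p) (visit q) x c
    (λ v → ne (place-injective p q v loc))
    (λ v → let p≡ = visit-origin p v in
           ne (trans p≡ (sym (location-origin q (trans (sym loc) (cong location p≡))))))
    (λ v → let q≡ = visit-origin q v in
           ne (trans (location-origin p (trans loc (cong location q≡))) (sym q≡)))

  -- The store speaks only of places on the tour. The field `off-tour` controls the remaining outer
  -- tracks, such as those of `pre j zero`, so that in the end every track other than the home track
  -- can be shown empty.
  record Represents (ext : Tape Symbol) (X : Store) : Set where
    constructor represents
    field
      cells     : ℕ → Cell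
      ext-cells : ∀ v → ext v ≡ encodeCell (cells v)
      on-tour   : ∀ n → get (visit (tour n)) (cells (location (tour n))) ≡ X n
      off-tour  : ∀ t v → t ≡ before ⊎ t ≡ after →
                  get t (cells v) ≡ empty ⊎ ∃[ n ] visit (tour n) ≡ t × location (tour n) ≡ v

  -- Injectivity of the tour keeps distinct indices on distinct tracks. An outer track can become
  -- non-empty only at the place being written, which itself witnesses that the track is on the
  -- tour.
  represents-update : ∀ {ext X X′} n x → (ρ : Represents ext X) → X′ ≗ update X n x →
    Represents (update ext (location (tour n))
      (encodeCell (set (visit (tour n)) x (Represents.cells ρ (location (tour n)))))) X′
  represents-update {ext} {X} {X′} n x (represents C ext-C on off) X′≗ = represents C′ ext-C′ on′ off′
    where
    p = tour n
    a = location p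
    c′ = set (visit p) x (C a)
    C′ = update C a c′
    ext-C′ : ∀ v → update ext a (encodeCell c′) v ≡ encodeCell (C′ v)
    ext-C′ v with a ≡ᵇ v
    ... | true  = refl
    ... | false = ext-C v
    on′ : ∀ m → get (visit (tour m)) (C′ (location (tour m))) ≡ X′ m
    on′ m with n ≟ m
    ... | yes refl = trans (cong (get (visit p)) (update-same C a c′))
                     (trans (get-set (visit p) x (C a)) (sym (trans (X′≗ n) (update-same X n x))))
    ... | no n≢m = trans here (trans (on m) (sym (trans (X′≗ m) (update-other X n x m n≢m))))
      where
      here : get (visit (tour m)) (C′ (location (tour m))) ≡ get (visit (tour m)) (C (location (tour m)))
      here with a ≟ location (tour m)
      ... | no ne = cong (get (visit (tour m))) (update-other C a c′ _ ne)
      ... | yes e = trans (cong (λ l → get (visit (tour m)) (C′ l)) (sym e))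
                    (trans (cong (get (visit (tour m))) (update-same C a c′))
                    (trans (get-set-place (tour m) p x (C a) (λ eq → n≢m (sym (tour-injective m n eq))) (sym e))
                           (cong (λ l → get (visit (tour m)) (C l)) e)))
    off′ : ∀ t v → t ≡ before ⊎ t ≡ after → get t (C′ v) ≡ empty ⊎ ∃[ n ] visit (tour n) ≡ t × location (tour n) ≡ v
    off′ t v outer with off t v outer
    ... | inj₂ r = inj₂ r
    ... | inj₁ e with a ≟ v
    ...   | no ne = inj₁ (trans (cong (get t) (update-other C a c′ v ne)) e)
    ...   | yes refl with visit p in vis
    ...     | atOrigin = inj₁ (trans (cong (get t) (update-same C a _)) (trans (keep outer) e))
      where
      keep : t ≡ before ⊎ t ≡ after → get t (set atOrigin x (C a)) ≡ get t (C a)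
      keep (inj₁ refl) = refl
      keep (inj₂ refl) = refl
    ...     | within = inj₁ (trans (cong (get t) (update-same C a _)) (trans (keep outer) e))
      where
      keep : t ≡ before ⊎ t ≡ after → get t (set within x (C a)) ≡ get t (C a)
      keep (inj₁ refl) = refl
      keep (inj₂ refl) = refl
    off′ t v (inj₁ refl) | inj₁ e | yes refl | before = inj₂ (n , vis , refl)
    off′ t v (inj₂ refl) | inj₁ e | yes refl | before = inj₁ (trans (cong (get after) (update-same C a _)) e)
    off′ t v (inj₁ refl) | inj₁ e | yes refl | after  = inj₁ (trans (cong (get before) (update-same C a _)) e)
    off′ t v (inj₂ refl) | inj₁ e | yes refl | after  = inj₂ (n , vis , refl)

  -- Runs of actions on the store

  data Here (m : Mode) (n : ℕ) (X : Store) : Config → Set where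
    here : ∀ {h t ext} → AtPlace (tour n) h t → Represents ext X →
           Here m n X (config (at (visit (tour n)) , m) (ext (location (tour n))) h t ext)

  data Halted (X : Store) : Config → Set where
    halted : ∀ {x h t ext} → Represents ext X → Halted X (config (halt , rest) x h t ext)

  -- Abstracts from addresses: a position is a tour index and a unit of cost is one action. A move
  -- to the left requires that the flag be seen exactly at index 1, the only information the machine
  -- has about the left end. Stores are compared pointwise because they are functions.
  data Run : Mode → ℕ → Store → ℕ → Mode → ℕ → Store → Set where
    done  : ∀ {m n X k} → Run m n X k m n X
    right : ∀ {m n X k m′ n′ Y m₁ x X₁} → act m (visit (tour n)) (X n) ≡ (x , right , m₁) → X₁ ≗ update X n x →
            Run m₁ (suc n) X₁ k m′ n′ Y → Run m n X (suc k) m′ n′ Y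
    left  : ∀ {m n X k m′ n′ Y m₁ x X₁} → act m (visit (tour (suc n))) (X (suc n)) ≡ (x , left , m₁) →
            isFirst (X (suc n)) ≡ (n ≡ᵇ 0) → X₁ ≗ update X (suc n) x →
            Run m₁ n X₁ k m′ n′ Y → Run m (suc n) X (suc k) m′ n′ Y
    stay  : ∀ {m n X k m′ n′ Y m₁ x X₁} → act m (visit (tour n)) (X n) ≡ (x , stay , m₁) → X₁ ≗ update X n x →
            Run m₁ n X₁ k m′ n′ Y → Run m n X (suc k) m′ n′ Y

  act-write : ∀ {m n X c m′ x d X′} → Here m n X c → act m (visit (tour n)) (X n) ≡ (x , d , m′) → X′ ≗ update X n x →
    ∃[ h ] ∃[ t ] ∃[ ext ] AtPlace (tour n) h t × Represents ext X′ ×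
      Reach c 2 (config (afterWrite (turn d (visit (tour n)) (X n)) (visit (tour n)) , m′) (ext (location (tour n))) h t ext)
  act-write {m} {n} {X} {m′ = m′} {x} {d} {X′} (here {h} {t} {ext} a ρ) eq X′≗ =
    h , t , update ext l y , a , represents-update n x ρ X′≗ ,
    tick-to (λ ()) refl refl result (rewriteA-place a)
      (write-step (λ ()) refl (subst₂ (λ l′ z → Reach (config (u , m′) y h t (update ext l′ y)) 0
                                               (config (u , m′) z h t (update ext l y)))
        (sym (address-place a)) (sym (update-same ext l y)) done))
    where
    open Represents ρ
    p = tour n
    l = location p
    v = visit p
    u = afterWrite (turn d v (X n)) v
    y = encodeCell (set v x (cells l))
    b = readA t h
    result : transition (at v , m) (decodeCell (ext l)) b ≡ ((wr (turn d v (X n)) v , m′) , set v x (cells l) , b , S)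
    result = trans (cong (λ c → transition (at v , m) c b) (trans (cong decodeCell (ext-cells l)) (decode-encodeCell (cells l))))
      (trans (cong (λ z → let x , d , m′ = act m v z in (wr (turn d v z) v , m′) , set v x (cells l) , b , S) (on-tour n))
             (cong (λ (x , d , m′) → (wr (turn d v (X n)) v , m′) , set v x (cells l) , b , S) eq))

  arrive : ∀ {m n X x h t ext} → AtPlace (tour n) h t → Represents ext X →
    ∃[ c ] Reach (config (rd (visit (tour n)) , m) x h t ext) 1 c × Here m n X c
  arrive {m} {n} {h = h} {t} {ext} a ρ = c , read-step (λ ()) refl
    (subst (λ l → Reach (config (at (visit (tour n)) , m) (ext l) h t ext) 0 c) (sym (address-place a)) done) , here a ρ
    where
    c = config (at (visit (tour n)) , m) (ext (location (tour n))) h t ext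

  arrive-after : ∀ {m n X c k u x h t ext p} → Represents ext X → p ≡ tour n →
    Reach c 2 (config (u , m) x h t ext) → Moved m ext u x h t k p →
    ∃[ c′ ] Reach c (2 + (k + 1)) c′ × Here m n X c′
  arrive-after ρ refl r (_ , _ , _ , r′ , a′) with arrive a′ ρ
  ... | c′ , r″ , H = c′ , reach-trans r (reach-trans r′ r″) , H

  -- Eight steps: one to apply the action, one to write, at most five to change the address, one to
  -- read.
  act-right : ∀ {m n X c m′ x X′} → Here m n X c → act m (visit (tour n)) (X n) ≡ (x , right , m′) → X′ ≗ update X n x →
    ∃[ c′ ] Reach c 8 c′ × Here m′ (suc n) X′ c′
  act-right H eq X′≗ with act-write H eq X′≗
  ... | h , t , ext , a , ρ , r = arrive-after ρ refl r (move-right _ ext a)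

  act-left : ∀ {m n X c m′ x X′} → Here m (suc n) X c → act m (visit (tour (suc n))) (X (suc n)) ≡ (x , left , m′) →
    isFirst (X (suc n)) ≡ (n ≡ᵇ 0) → X′ ≗ update X (suc n) x → ∃[ c′ ] Reach c 8 c′ × Here m′ n X′ c′
  act-left {n = zero} {X} H eq fst X′≗ with act-write H eq X′≗
  ... | h , t , ext , a , ρ , r rewrite fst = arrive-after ρ refl r (move-toOrigin _ ext a)
  act-left {n = suc n} {X} {c} {m′} H eq fst X′≗ with act-write H eq X′≗
  ... | h , t , ext , a , ρ , r = arrive-after ρ (stepL-tour (suc n))
    (subst (λ d → Reach c 2 (config (afterWrite d (visit (tour (2 + n))) , m′) (ext (location (tour (2 + n)))) h t ext))
      (no-turn (visit (tour (2 + n))) (X (2 + n)) fst) r)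
    (move-left _ ext a (tour-suc≢origin (suc n)) (tour≢first n))
    where
    no-turn : ∀ v x → isFirst x ≡ false → turn left v x ≡ left
    no-turn atOrigin x e = refl
    no-turn before   x e = refl
    no-turn within   x e rewrite e = refl
    no-turn after    x e = refl

  act-stay : ∀ {m n X c m′ x X′} → Here m n X c → act m (visit (tour n)) (X n) ≡ (x , stay , m′) → X′ ≗ update X n x →
    ∃[ c′ ] Reach c 8 c′ × Here m′ n X′ c′
  act-stay H eq X′≗ with act-write H eq X′≗
  ... | h , t , ext , a , ρ , r = _ , reach-weaken (s≤s (s≤s z≤n)) r , here a ρ

  act-stop : ∀ {m n X c x X′} → Here m n X c → act m (visit (tour n)) (X n) ≡ (x , stop , rest) → X′ ≗ update X n x →
    ∃[ c′ ] Reach c 2 c′ × Halted X′ c′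
  act-stop H eq X′≗ with act-write H eq X′≗
  ... | h , t , ext , a , ρ , r = _ , r , halted ρ

  simulate : ∀ {m n X k m′ n′ X′ c} → Run m n X k m′ n′ X′ → Here m n X c → ∃[ c′ ] Reach c (k * 8) c′ × Here m′ n′ X′ c′
  simulate done H = _ , done , H
  simulate (right e w r) H with act-right H e w
  ... | _ , r₁ , H₁ with simulate r H₁
  ...   | c′ , r₂ , H₂ = c′ , reach-trans r₁ r₂ , H₂
  simulate (left e f w r) H with act-left H e f w
  ... | _ , r₁ , H₁ with simulate r H₁
  ...   | c′ , r₂ , H₂ = c′ , reach-trans r₁ r₂ , H₂
  simulate (stay e w r) H with act-stay H e w
  ... | _ , r₁ , H₁ with simulate r H₁
  ...   | c′ , r₂ , H₂ = c′ , reach-trans r₁ r₂ , H₂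

  run-weaken : ∀ {m n X k l m′ n′ X′} → k ≤ l → Run m n X k m′ n′ X′ → Run m n X l m′ n′ X′
  run-weaken k≤l       done            = done
  run-weaken (s≤s k≤l) (right e w r)   = right e w (run-weaken k≤l r)
  run-weaken (s≤s k≤l) (left e f w r)  = left e f w (run-weaken k≤l r)
  run-weaken (s≤s k≤l) (stay e w r)    = stay e w (run-weaken k≤l r)

  run-trans : ∀ {m₁ n₁ X₁ k m₂ n₂ X₂ l m₃ n₃ X₃} →
    Run m₁ n₁ X₁ k m₂ n₂ X₂ → Run m₂ n₂ X₂ l m₃ n₃ X₃ → Run m₁ n₁ X₁ (k + l) m₃ n₃ X₃
  run-trans {k = k} {l = l} done r = run-weaken (m≤n+m l k) r
  run-trans (right e w r)  r′ = right e w (run-trans r r′)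
  run-trans (left e f w r) r′ = left e f w (run-trans r r′)
  run-trans (stay e w r)   r′ = stay e w (run-trans r r′)

  -- Walks through vacant places

  update-self : ∀ {X : Store} {n x} → X n ≡ x → X ≗ update X n x
  update-self {X} {n} {x} e m with n ≟ m
  ... | yes refl = trans e (sym (update-same X n x))
  ... | no n≢m   = sym (update-other X n x m n≢m)

  walk-right : ∀ {m X} → (∀ v → act m v empty ≡ (empty , right , m)) → ∀ k n →
    (∀ i → n ≤ i → i < n + k → X i ≡ empty) → Run m n X k m (n + k) X
  walk-right {m} {X} am zero n vac = subst (λ i → Run m n X 0 m i X) (sym (+-identityʳ n)) done
  walk-right {m} {X} am (suc k) n vac = right (trans (cong (act m _) e) (am _)) (update-self e)
    (subst (λ i → Run m (suc n) X k m i X) (sym (+-suc n k))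
      (walk-right am k (suc n) (λ i n<i i< → vac i (<⇒≤ n<i) (subst (i <_) (sym (+-suc n k)) i<))))
    where
    e = vac n ≤-refl (m<m+n n (s≤s z≤n))

  -- An empty place carries no flag, so a non-trivial walk must end at index 1 or beyond. The
  -- predicate `Ok` serves the mode `restL`, which passes only over visits that are not in-order.
  walk-left : ∀ {m X} (Ok : Visit → Set) → (∀ v → Ok v → act m v empty ≡ (empty , left , m)) → ∀ k n →
    (∀ i → n < i → i ≤ n + k → X i ≡ empty × Ok (visit (tour i))) → k ≡ 0 ⊎ 1 ≤ n → Run m (n + k) X k m n X
  walk-left {m} {X} Ok am zero n vac pos? = subst (λ i → Run m i X 0 m n X) (sym (+-identityʳ n)) done
  walk-left {m} {X} Ok am (suc k) (suc n) vac (inj₂ _) = subst (λ i → Run m i X (suc k) m (suc n) X) (sym (+-suc (suc n) k))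
    (left (trans (cong (act m _) e) (am _ o)) (cong isFirst e) (update-self e)
      (walk-left Ok am k (suc n) (λ i n<i i≤ → vac i n<i (≤-trans i≤ (+-monoʳ-≤ (suc n) (n≤1+n k)))) (inj₂ (s≤s z≤n))))
    where
    eo = vac (suc (suc n + k)) (s≤s (m≤m+n (suc n) k)) (≤-reflexive (sym (+-suc (suc n) k)))
    e = proj₁ eo
    o = proj₂ eo

  count-right : ∀ {X} (F : Fin 4 → Mode) → (∀ c v → act (F (fs c)) v empty ≡ (empty , right , F (inject₁ c))) → ∀ k c n →
    k ≤ toℕ c → (∀ i → n ≤ i → i < n + k → X i ≡ empty) →
    ∃[ c′ ] toℕ c′ + k ≡ toℕ c × Run (F c) n X k (F c′) (n + k) X
  count-right {X} F aF zero c n _ vac =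
    c , +-identityʳ (toℕ c) , subst (λ i → Run (F c) n X 0 (F c) i X) (sym (+-identityʳ n)) done
  count-right {X} F aF (suc k) (fs c) n (s≤s k≤c) vac
    with count-right F aF k (inject₁ c) (suc n) (subst (k ≤_) (sym (toℕ-inject₁ c)) k≤c)
           (λ i n<i i< → vac i (<⇒≤ n<i) (subst (i <_) (sym (+-suc n k)) i<))
  ... | c′ , eq , r = c′ , trans (+-suc (toℕ c′) k) (cong suc (trans eq (toℕ-inject₁ c))) ,
    right (trans (cong (act (F (fs c)) _) e) (aF c _)) (update-self e)
      (subst (λ i → Run (F (inject₁ c)) (suc n) X k (F c′) i X) (sym (+-suc n k)) r)
    where
    e = vac n ≤-refl (m<m+n n (s≤s z≤n))

  -- Explored cells have to be distinguishable from fresh ones, which is what `used` says. The head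
  -- cell is exempt because it may have been entered without having been written. By `athome` an
  -- explored cell that is still native needs no transport when the cells are returned.
  record Inv (p h : ℕ) (t : Tape Γ) (X : Store) : Set where
    field
      cell     : ℕ → Status
      filled   : ∀ z → X (slots p z) ≡ cell z
      vacant   : ∀ n → (∀ z → slots p z ≢ n) → X n ≡ empty
      contents : ∀ z → content (cell z) ≡ t z
      nonempty : ∀ z → cell z ≢ empty
      fresh    : ∀ z → p < z → cell z ≡ native plain (t z)
      used     : ∀ z → z ≤ p → z ≢ h → ∀ a → cell z ≢ native plain a
      isfirst  : ∀ z → z ≤ p → isFirst (cell z) ≡ (z ≡ᵇ 1)
      athome   : ∀ z → z ≤ p → ∀ k a → cell z ≡ native k a → slot z ≡ pos z
  open Inv

  content-setContent : ∀ x a → x ≢ empty → content (setContent x a) ≡ a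
  content-setContent empty              a ne = ⊥-elim (ne refl)
  content-setContent (guest _)          a ne = refl
  content-setContent (native plain _)   a ne = refl
  content-setContent (native visited _) a ne = refl
  content-setContent (native first _)   a ne = refl

  setContent-nonempty : ∀ x a → x ≢ empty → setContent x a ≢ empty
  setContent-nonempty empty              a ne e = ne refl
  setContent-nonempty (native plain _)   a ne ()
  setContent-nonempty (native visited _) a ne ()
  setContent-nonempty (native first _)   a ne ()

  setContent-used : ∀ x a b → setContent x a ≢ native plain b
  setContent-used (native plain _)   a b ()
  setContent-used (native visited _) a b ()
  setContent-used (native first _)   a b ()

  setContent-first : ∀ x a → isFirst (setContent x a) ≡ isFirst x
  setContent-first empty              a = refl
  setContent-first (guest _)          a = refl
  setContent-first (native plain _)   a = refl
  setContent-first (native visited _) a = refl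
  setContent-first (native first _)   a = refl

  setContent-native : ∀ x a k b → setContent x a ≡ native k b → ∃[ k′ ] ∃[ b′ ] x ≡ native k′ b′
  setContent-native (native plain _)   a k b _ = _ , _ , refl
  setContent-native (native visited _) a k b _ = _ , _ , refl
  setContent-native (native first _)   a k b _ = _ , _ , refl

  -- The written cell is no longer plain, so the exemption in `used` may pass to any `h′`.
  write-cell : ∀ {p h t X} h′ a → (I : Inv p h t X) → h ≤ p →
    Inv p h′ (update t h a) (update X (slots p h) (setContent (cell I h) a))
  write-cell {p} {h} {t} {X} h′ a I h≤p = record
    { cell     = cell′
    ; filled   = filled′
    ; vacant   = λ n ne → trans (update-other X (slots p h) x n (ne h)) (vacant I n ne)
    ; contents = contents′
    ; nonempty = nonempty′
    ; fresh    = λ z p<z → let h≢z = <⇒≢ (≤-<-trans h≤p p<z) in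
        trans (update-other (cell I) h x z h≢z)
        (trans (fresh I z p<z) (cong (native plain) (sym (update-other t h a z h≢z))))
    ; used     = used′
    ; isfirst  = isfirst′
    ; athome   = athome′
    }
    where
    x = setContent (cell I h) a
    cell′ : ℕ → Status
    cell′ = update (cell I) h x
    same : cell′ h ≡ x
    same = update-same (cell I) h x
    other : ∀ {z} → h ≢ z → cell′ z ≡ cell I z
    other {z} = update-other (cell I) h x z
    filled′ : ∀ z → update X (slots p h) x (slots p z) ≡ cell′ z
    filled′ z with h ≟ z
    ... | yes refl = trans (update-same X (slots p h) x) (sym same)
    ... | no ne = trans (update-other X (slots p h) x _ (ne ∘ slots-injective p)) (trans (filled I z) (sym (other ne)))
    contents′ : ∀ z → content (cell′ z) ≡ update t h a z
    contents′ z with h ≟ z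
    ... | yes refl = trans (cong content same)
                     (trans (content-setContent (cell I h) a (nonempty I h)) (sym (update-same t h a)))
    ... | no ne = trans (cong content (other ne)) (trans (contents I z) (sym (update-other t h a z ne)))
    nonempty′ : ∀ z → cell′ z ≢ empty
    nonempty′ z e with h ≟ z
    ... | yes refl = setContent-nonempty (cell I h) a (nonempty I h) (trans (sym same) e)
    ... | no ne = nonempty I z (trans (sym (other ne)) e)
    used′ : ∀ z → z ≤ p → z ≢ h′ → ∀ b → cell′ z ≢ native plain b
    used′ z z≤p _ b e with h ≟ z
    ... | yes refl = setContent-used (cell I h) a b (trans (sym same) e)
    ... | no ne = used I z z≤p (ne ∘ sym) b (trans (sym (other ne)) e)
    isfirst′ : ∀ z → z ≤ p → isFirst (cell′ z) ≡ (z ≡ᵇ 1)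
    isfirst′ z z≤p with h ≟ z
    ... | yes refl = trans (cong isFirst same) (trans (setContent-first (cell I h) a) (isfirst I h z≤p))
    ... | no ne = trans (cong isFirst (other ne)) (isfirst I z z≤p)
    athome′ : ∀ z → z ≤ p → ∀ k b → cell′ z ≡ native k b → slot z ≡ pos z
    athome′ z z≤p k b e with h ≟ z
    ... | no ne = athome I z z≤p k b (trans (sym (other ne)) e)
    ... | yes refl with setContent-native (cell I h) a k b (trans (sym same) e)
    ...   | k′ , b′ , e′ = athome I h z≤p k′ b′ e′

  vacant-between : ∀ {p h t X} → Inv p h t X → ∀ z n → slots p z < n → n < slots p (suc z) → X n ≡ empty
  vacant-between I z n z<n n<z = vacant I n (between-slots _ z n z<n n<z)

  -- For `z = 0` there is nothing to walk, since cell 1 always rests at tour index 1; hence no empty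
  -- place ever has to announce the left end.
  walk-back : ∀ {p h t X m} → Inv p h t X → (∀ v → act m v empty ≡ (empty , left , m)) → ∀ z n →
    slots p z ≤ n → n < slots p (suc z) → Run m n X (n ∸ slots p z) m (slots p z) X
  walk-back {p} {X = X} {m} I am z n lo n<z = subst (λ i → Run m i X (n ∸ slots p z) m (slots p z) X) (m+[n∸m]≡n lo)
    (walk-left (λ _ → ⊤) (λ v _ → am v) (n ∸ slots p z) (slots p z)
      (λ i z<i i≤n → vacant-between I z i z<i (≤-<-trans (≤-trans i≤n (≤-reflexive (m+[n∸m]≡n lo))) n<z) , tt) (start z lo n<z))
    where
    start : ∀ z → slots p z ≤ n → n < slots p (suc z) → n ∸ slots p z ≡ 0 ⊎ 1 ≤ slots p z
    start zero    _ n<1 = inj₁ (trans (cong (n ∸_) (slots-origin p)) (n<1⇒n≡0 (subst (n <_) (slots-first p) n<1)))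
    start (suc z) _ _   = inj₂ (slots-positive p z)

  act-filled-goL : ∀ q v x → x ≢ empty → act (goL q) v x ≡ (x , stay , exec q)
  act-filled-goL q v empty        ne = ⊥-elim (ne refl)
  act-filled-goL q v (guest _)    ne = refl
  act-filled-goL q v (native _ _) ne = refl

  act-filled-finL : ∀ v x → x ≢ empty → act finL v x ≡ (x , stay , rest)
  act-filled-finL v empty        ne = ⊥-elim (ne refl)
  act-filled-finL v (guest _)    ne = refl
  act-filled-finL v (native _ _) ne = refl

  act-filled-scan : ∀ c q v x → x ≢ empty → act (scan c q) v x ≡ (x , stay , exec q)
  act-filled-scan c      q v empty        ne = ⊥-elim (ne refl)
  act-filled-scan fz     q v (guest _)    ne = refl
  act-filled-scan fz     q v (native _ _) ne = refl
  act-filled-scan (fs c) q v (guest _)    ne = refl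
  act-filled-scan (fs c) q v (native _ _) ne = refl

  tour-visit≢origin : ∀ n → visit (tour (suc n)) ≢ atOrigin
  tour-visit≢origin n e = tour-suc≢origin n (visit-origin _ e)

  three : Fin 4
  three = fs (fs (fs fz))

  step-back : ∀ {p h t X X₁ m m₁ x} → Inv p h t X₁ → (∀ v → act m₁ v empty ≡ (empty , left , m₁)) → ∀ z →
    let n = slots p (suc z) in
    act m (visit (tour n)) (X n) ≡ (x , left , m₁) → isFirst (X n) ≡ (suc z ≡ᵇ 1) → X₁ ≗ update X n x →
    Run m n X (n ∸ slots p z) m₁ (slots p z) X₁
  step-back {p} {X = X} {X₁} {m} {m₁} {x} I am z = go (slots p (suc z)) refl
    where
    go : ∀ n → slots p (suc z) ≡ n → act m (visit (tour n)) (X n) ≡ (x , left , m₁) →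
      isFirst (X n) ≡ (suc z ≡ᵇ 1) → X₁ ≗ update X n x → Run m n X (n ∸ slots p z) m₁ (slots p z) X₁
    go zero    eq = ⊥-elim (<⇒≢ (slots-positive p z) (sym eq))
    go (suc n) eq a f w = subst (λ k → Run m (suc n) X k m₁ (slots p z) X₁) (sym (+-∸-assoc 1 below))
      (left a (trans f (≡ᵇ-slots p z n eq)) w (walk-back I am z n below (≤-reflexive (sym eq))))
      where
      below : slots p z ≤ n
      below = ≤-pred (subst (slots p z <_) eq (slots-suc p z))

  module _ {p h t X} (I : Inv p h t X) (F : Fin 4 → Mode)
           (aF : ∀ c v → act (F (fs c)) v empty ≡ (empty , right , F (inject₁ c))) where

    -- At most three places lie strictly between the two cells, so a counter that starts at three
    -- does not run out before the next cell is met.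
    approach : ∀ z → slots p (suc z) ≤ slots p z + 4 →
      ∃[ c ] Run (F three) (suc (slots p z)) X 3 (F c) (slots p (suc z)) X
    approach z near with m≤n⇒∃[o]m+o≡n (slots-suc p z)
    ... | k , eq with count-right F aF k three (suc (slots p z)) k≤3
                        (λ i lo hi → vacant-between I z i lo (subst (i <_) eq hi))
      where
      k≤3 : k ≤ 3
      k≤3 = +-cancelˡ-≤ (suc (slots p z)) k 3
        (≤-trans (≤-reflexive eq) (≤-trans near (≤-reflexive (+-suc (slots p z) 3))))
    ...   | c , c+k≡3 , r = c , run-weaken (m+n≤o⇒n≤o (toℕ c) (≤-reflexive c+k≡3))
      (subst (λ n → Run (F three) (suc (slots p z)) X k (F c) n X) eq r)

    overrun : ∀ z → slots p z + 4 < slots p (suc z) →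
      Run (F three) (suc (slots p z)) X 3 (F fz) (slots p z + 4) X
    overrun z far with count-right F aF 3 three (suc (slots p z)) ≤-refl
                        (λ i lo hi → vacant-between I z i lo (<-trans (subst (i <_) (sym (+-suc (slots p z) 3)) hi) far))
    ... | c , eq , r with c | eq
    ...   | fz | _ = subst (λ n → Run (F three) (suc (slots p z)) X 3 (F fz) n X) (sym (+-suc (slots p z) 3)) r
    ...   | fs c′ | e = ⊥-elim (0≢1+n (sym (+-cancelʳ-≡ 3 (suc (toℕ c′)) 0 e)))

  -- Here the slot is the home, so the store stays as it is and only the frontier advances. The
  -- condition `1 ≤ p` ensures that the newly explored cell is not the flagged one.
  extend-near : ∀ {p t X} → 1 ≤ p → slot (suc p) ≡ pos (suc p) → Inv p (suc p) t X → Inv (suc p) (suc p) t X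
  extend-near {p} {t} {X} 1≤p home I = record
    { cell     = cell I
    ; filled   = λ z → trans (cong X (same z)) (filled I z)
    ; vacant   = λ n ne → vacant I n (λ z e → ne z (trans (same z) e))
    ; contents = contents I
    ; nonempty = nonempty I
    ; fresh    = λ z p<z → fresh I z (<-trans (n<1+n p) p<z)
    ; used     = λ z z≤ z≢ → used I z (≤-pred (≤∧≢⇒< z≤ z≢)) z≢
    ; isfirst  = isfirst′
    ; athome   = athome′
    }
    where
    same : ∀ z → slots (suc p) z ≡ slots p z
    same z with z ≟ suc p
    ... | yes refl = trans (slots-explored (suc p) (suc p) ≤-refl) (trans home (sym (slots-fresh p (suc p) (n<1+n p))))
    ... | no ne    = slots-extend p z ne
    isfirst′ : ∀ z → z ≤ suc p → isFirst (cell I z) ≡ (z ≡ᵇ 1)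
    isfirst′ z z≤ with z ≟ suc p
    ... | no ne = isfirst I z (≤-pred (≤∧≢⇒< z≤ ne))
    ... | yes refl = trans (cong isFirst (fresh I (suc p) (n<1+n p)))
      (sym (≢⇒≡ᵇ-false (suc p) 1 (λ e → <⇒≢ (s≤s 1≤p) (sym e))))
    athome′ : ∀ z → z ≤ suc p → ∀ k a → cell I z ≡ native k a → slot z ≡ pos z
    athome′ z z≤ with z ≟ suc p
    ... | no ne = athome I z (≤-pred (≤∧≢⇒< z≤ ne))
    ... | yes refl = λ _ _ _ → home

  -- guest blank marks the slot g while the native cell p + 1 is fetched.
  steal : ℕ → ℕ → Γ → Store → Store
  steal p g a X = update (update (update X g (guest blank)) (pos (suc p)) empty) g (guest a)

  extend-far : ∀ {p t X} → 1 ≤ p → slot (suc p) < pos (suc p) → (∀ z → slots p z ≢ slot (suc p)) →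
    Inv p (suc p) t X → Inv (suc p) (suc p) t (steal p (slot (suc p)) (t (suc p)) X)
  extend-far {p} {t} {X} 1≤p g<b vac I = record
    { cell     = cell′
    ; filled   = filled′
    ; vacant   = vacant′
    ; contents = contents′
    ; nonempty = nonempty′
    ; fresh    = λ z p<z → trans (other (<⇒≢ p<z)) (fresh I z (<-trans (n<1+n p) p<z))
    ; used     = λ z z≤ z≢ a e → used I z (≤-pred (≤∧≢⇒< z≤ z≢)) z≢ a (trans (sym (other (z≢ ∘ sym))) e)
    ; isfirst  = isfirst′
    ; athome   = athome′
    }
    where
    g = slot (suc p)
    b = pos (suc p)
    a = t (suc p)
    cell′ : ℕ → Status
    cell′ = update (cell I) (suc p) (guest a)
    same : cell′ (suc p) ≡ guest a
    same = update-same (cell I) (suc p) (guest a)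
    other : ∀ {z} → suc p ≢ z → cell′ z ≡ cell I z
    other {z} = update-other (cell I) (suc p) (guest a) z
    fresh-slot : slots p (suc p) ≡ b
    fresh-slot = slots-fresh p (suc p) (n<1+n p)
    outside : ∀ {n} → g ≢ n → b ≢ n → steal p g a X n ≡ X n
    outside {n} g≢ b≢ = trans (update-other (update (update X g (guest blank)) b empty) g (guest a) n g≢)
      (trans (update-other (update X g (guest blank)) b empty n b≢) (update-other X g (guest blank) n g≢))
    filled′ : ∀ z → steal p g a X (slots (suc p) z) ≡ cell′ z
    filled′ z with suc p ≟ z
    ... | yes refl = trans (cong (steal p g a X) (slots-explored (suc p) (suc p) ≤-refl))
                     (trans (update-same (update (update X g (guest blank)) b empty) g (guest a)) (sym same))
    ... | no ne = trans (cong (steal p g a X) (slots-extend p z (ne ∘ sym)))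
                  (trans (outside (vac z ∘ sym) (λ e → ne (slots-injective p (trans fresh-slot e))))
                  (trans (filled I z) (sym (other ne))))
    vacant′ : ∀ n → (∀ z → slots (suc p) z ≢ n) → steal p g a X n ≡ empty
    vacant′ n ne with b ≟ n
    ... | yes refl = trans (update-other (update (update X g (guest blank)) b empty) g (guest a) b (<⇒≢ g<b)) (update-same (update X g (guest blank)) b empty)
    ... | no b≢n = trans (outside (λ e → ne (suc p) (trans (slots-explored (suc p) (suc p) ≤-refl) e)) b≢n) (vacant I n away)
      where
      away : ∀ z → slots p z ≢ n
      away z e with suc p ≟ z
      ... | yes refl = b≢n (trans (sym fresh-slot) e)
      ... | no z≢ = ne z (trans (slots-extend p z (z≢ ∘ sym)) e)
    contents′ : ∀ z → content (cell′ z) ≡ t z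
    contents′ z with suc p ≟ z
    ... | yes refl = cong content same
    ... | no ne = trans (cong content (other ne)) (contents I z)
    nonempty′ : ∀ z → cell′ z ≢ empty
    nonempty′ z e with suc p ≟ z
    ... | no ne = nonempty I z (trans (sym (other ne)) e)
    ... | yes refl with trans (sym same) e
    ...   | ()
    isfirst′ : ∀ z → z ≤ suc p → isFirst (cell′ z) ≡ (z ≡ᵇ 1)
    isfirst′ z z≤ with suc p ≟ z
    ... | no ne = trans (cong isFirst (other ne)) (isfirst I z (≤-pred (≤∧≢⇒< z≤ (ne ∘ sym))))
    ... | yes refl = trans (cong isFirst same) (sym (≢⇒≡ᵇ-false (suc p) 1 (λ e → <⇒≢ (s≤s 1≤p) (sym e))))
    athome′ : ∀ z → z ≤ suc p → ∀ k c → cell′ z ≡ native k c → slot z ≡ pos z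
    athome′ z z≤ k c e with suc p ≟ z
    ... | no ne = athome I z (≤-pred (≤∧≢⇒< z≤ (ne ∘ sym))) k c (trans (sym (other ne)) e)
    ... | yes refl with trans (sym same) e
    ...   | ()

  -- Simulated steps

  lag≤load : ∀ z → lag z ≤ load z
  lag≤load z = ≤-trans (m≤m+n (lag z) (height z)) (lag+height≤load z)

  slots-gap : ∀ {p z} → suc z ≤ p → slots p (suc z) ≤ slots p z + 4
  slots-gap {p} {z} z<p rewrite slots-explored p (suc z) z<p | slots-explored p z (<⇒≤ z<p) = slot-step z

  exec-act : ∀ {q q′ a mv} v x → q ≢ acceptM → δM q (content x) ≡ (q′ , a , mv) →
    act (exec q) v x ≡ (setContent x a , shift mv v q′)
  exec-act {q} v x ne e with q ≟F acceptM
  ... | yes eq = ⊥-elim (ne eq)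
  ... | no _ rewrite e = refl

  shift-left : ∀ {v} q → v ≢ atOrigin → shift L v q ≡ (left , goL q)
  shift-left {atOrigin} q ne = ⊥-elim (ne refl)
  shift-left {before}   q ne = refl
  shift-left {within}   q ne = refl
  shift-left {after}    q ne = refl

  -- The first non-empty place to the right of `g` is the home of the wanted cell, and the marker at
  -- `g` stops the way back. One action sets the marker, `d` go each way, one turns round and one
  -- replaces the marker.
  steal-run : ∀ {X q a} g d → 1 ≤ g → (∀ i → g ≤ i → i < suc (g + d) → X i ≡ empty) →
    X (suc (g + d)) ≡ native plain a →
    Run (scan fz q) g X (suc (d + suc (d + 1))) (exec q) g
      (update (update (update X g (guest blank)) (suc (g + d)) empty) g (guest a))
  steal-run {X} {q} {a} g d 1≤g vac home =
    right (cong (act (scan fz q) _) (vac g ≤-refl (s≤s (m≤m+n g d)))) (λ _ → refl)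
    (run-trans (walk-right (λ _ → refl) d (suc g) (λ i lo hi → trans (X₁-other (<⇒≢ lo)) (vac i (<⇒≤ lo) hi)))
    (left (cong (act (fetch q) _) home₁)
      (trans (cong isFirst home₁) (sym (≢⇒≡ᵇ-false (g + d) 0 (λ e → <⇒≢ (≤-trans 1≤g (m≤m+n g d)) (sym e))))) (λ _ → refl)
    (run-trans (walk-left (λ _ → ⊤) (λ _ _ → refl) d g (λ i lo hi →
        trans (update-other X₁ (suc (g + d)) empty i (<⇒≢ (s≤s hi) ∘ sym))
        (trans (X₁-other (<⇒≢ lo)) (vac i (<⇒≤ lo) (s≤s hi))) , tt) (inj₂ 1≤g))
    (stay (cong (act (back a q) _) (trans (update-other X₁ (suc (g + d)) empty g (<⇒≢ (s≤s (m≤m+n g d)) ∘ sym)) (update-same X g (guest blank))))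
      (λ _ → refl) done))))
    where
    X₁ = update X g (guest blank)
    X₁-other : ∀ {i} → g ≢ i → X₁ i ≡ X i
    X₁-other {i} = update-other X g (guest blank) i
    home₁ : X₁ (suc (g + d)) ≡ native plain a
    home₁ = trans (X₁-other (<⇒≢ (s≤s (m≤m+n g d)))) home

  -- Amortised cost with potential `2 * total p`. A simulated step takes at most 5 actions, within
  -- the allowance of 12, plus twice the lag of a cell that is moved; the latter is charged to the
  -- increase of `total`.
  Stepped : ℕ → ℕ → Fin nM → Store → Fin nM → ℕ → Tape Γ → Set
  Stepped p n q X q′ h′ t′ = ∃[ p′ ] ∃[ X′ ] ∃[ k ] Run (exec q) n X k (exec q′) (slots p′ h′) X′
    × Inv p′ h′ t′ X′ × p ≤ p′ × h′ ≤ p′ × p′ ≤ suc p × k + 2 * total p ≤ 12 + 2 * total p′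

  module _ {p h t X} (I : Inv p h t X) (1≤p : 1 ≤ p) (h≤p : h ≤ p) {q q′ a mv}
           (q≢ : q ≢ acceptM) (δq : δM q (t h) ≡ (q′ , a , mv)) where

    private
      n = slots p h
      X₁ = update X n (setContent (cell I h) a)
      t₁ = update t h a

    exec-cell : act (exec q) (visit (tour n)) (X n) ≡ (setContent (cell I h) a , shift mv (visit (tour n)) q′)
    exec-cell = trans (cong (act (exec q) _) (filled I h))
      (exec-act _ (cell I h) q≢ (trans (cong (δM q) (contents I h)) δq))

    written : ∀ h′ → Inv p h′ t₁ X₁
    written h′ = write-cell h′ a I h≤p

    within-budget : ∀ {k} → k ≤ 12 → k + 2 * total p ≤ 12 + 2 * total p
    within-budget = +-monoˡ-≤ (2 * total p)

    step-S : mv ≡ S → Stepped p n q X q′ h t₁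
    step-S refl = p , X₁ , 1 , stay exec-cell (λ _ → refl) done ,
      written h , ≤-refl , h≤p , n≤1+n p , within-budget (s≤s z≤n)

    step-L-origin : mv ≡ L → h ≡ 0 → Stepped p n q X q′ 0 t₁
    step-L-origin refl refl = p , X₁ , 1 , stay (trans exec-cell (cong (λ v → setContent (cell I 0) a , shift L v q′) at-origin)) (λ _ → refl) done ,
      written 0 , ≤-refl , z≤n , n≤1+n p , within-budget (s≤s z≤n)
      where
      at-origin : visit (tour (slots p 0)) ≡ atOrigin
      at-origin = cong (visit ∘ tour) (slots-origin p)

    step-L : mv ≡ L → ∀ h′ → h ≡ suc h′ → Stepped p n q X q′ h′ t₁
    step-L refl h′ refl = p , X₁ , n ∸ slots p h′ + 1 ,
      run-trans (step-back (written h′) (λ _ → refl) h′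
        (trans exec-cell (cong (setContent (cell I h) a ,_) (shift-left q′ not-origin)))
        (trans (cong isFirst (filled I h)) (isfirst I h h≤p)) (λ _ → refl))
        (stay (trans (cong (act (goL q′) _) (filled (written h′) h′)) (act-filled-goL q′ _ _ (nonempty (written h′) h′)))
          (update-self (filled (written h′) h′)) done) ,
      written h′ , ≤-refl , <⇒≤ h≤p , n≤1+n p , within-budget (≤-trans (+-monoˡ-≤ 1 gap) (m≤n+m 5 7))
      where
      gap : n ∸ slots p h′ ≤ 4
      gap = ≤-trans (∸-monoˡ-≤ (slots p h′) (slots-gap h≤p)) (≤-reflexive (m+n∸m≡n (slots p h′) 4))
      not-origin : visit (tour n) ≢ atOrigin
      not-origin e with slots p (suc h′) | slots-positive p h′
      ... | suc m | _ = tour-visit≢origin m e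

    step-R : mv ≡ R → Stepped p n q X q′ (suc h) t₁
    step-R refl with slots p (suc h) ≤? n + 4
    ... | yes near with approach (written (suc h)) (λ c → scan c q′) (λ _ _ → refl) h near
    ...   | c , r = finish (suc h ≤? p)
      where
      I₁ = written (suc h)
      run : Run (exec q) n X (suc (3 + 1)) (exec q′) (slots p (suc h)) X₁
      run = right exec-cell (λ _ → refl) (run-trans r
        (stay (trans (cong (act (scan c q′) _) (filled I₁ (suc h))) (act-filled-scan c q′ _ _ (nonempty I₁ (suc h))))
          (update-self (filled I₁ (suc h))) done))
      finish : _ → Stepped p n q X q′ (suc h) t₁
      finish (yes h<p) = p , X₁ , 5 , run , I₁ , ≤-refl , h<p , n≤1+n p , within-budget (m≤n+m 5 7)
      finish (no h≮p) with ≤-antisym h≤p (≤-pred (≰⇒> h≮p))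
      ... | refl = suc p , X₁ , 5 ,
        subst (λ i → Run (exec q) n X 5 (exec q′) i X₁) same run ,
        extend-near 1≤p resident I₁ , n≤1+n p , ≤-refl , ≤-refl ,
        +-mono-≤ (m≤n+m 5 7) (*-monoʳ-≤ 2 (m≤m+n (total p) _))
        where
        fresh-slot : slots p (suc p) ≡ pos (suc p)
        fresh-slot = slots-fresh p (suc p) (n<1+n p)
        resident : slot (suc p) ≡ pos (suc p)
        resident = m≥n⇒m⊓n≡n (subst₂ (λ x y → x ≤ y + 4) fresh-slot (slots-explored p p ≤-refl) near)
        same : slots p (suc p) ≡ slots (suc p) (suc p)
        same = trans fresh-slot (trans (sym resident) (sym (slots-explored (suc p) (suc p) ≤-refl)))
    -- Explored neighbours lie within four tour steps, so a neighbour farther away is the first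
    -- unexplored cell and the head is at the frontier.
    step-R refl | no far with ≤-antisym h≤p (≤-pred (≰⇒> (far ∘ slots-gap)))
    ... | refl = suc p , steal p g a′ X₁ , suc (3 + suc (d + suc (d + 1))) ,
      right exec-cell (λ _ → refl) (run-trans
        (subst (λ i → Run (scan three q′) (suc n) X₁ 3 (scan fz q′) i X₁) n+4≡g (overrun I₁ (λ c → scan c q′) (λ _ _ → refl) p far′))
        (subst₂ (λ i b → Run (scan fz q′) g X₁ (suc (d + suc (d + 1))) (exec q′) i
                   (update (update (update X₁ g (guest blank)) b empty) g (guest a′)))
          (sym (slots-explored (suc p) (suc p) ≤-refl)) b≡
          (steal-run g d 1≤g (λ i lo hi → vacant-between I₁ p i (<-≤-trans n<g lo) (subst (i <_) (trans b≡ (sym fresh-slot)) hi))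
            (trans (cong X₁ (trans b≡ (sym fresh-slot))) (trans (filled I₁ (suc p)) (fresh I₁ (suc p) (n<1+n p))))))) ,
      extend-far 1≤p g<b (between-slots p p g n<g (subst (g <_) (sym fresh-slot) g<b)) I₁ ,
      n≤1+n p , ≤-refl , ≤-refl , cost
      where
      I₁ = written (suc p)
      g = slot (suc p)
      a′ = t₁ (suc p)
      far′ : n + 4 < slots p (suc p)
      far′ = ≰⇒> far
      fresh-slot : slots p (suc p) ≡ pos (suc p)
      fresh-slot = slots-fresh p (suc p) (n<1+n p)
      n≡ : n ≡ slot p
      n≡ = slots-explored p p ≤-refl
      n+4≡g : n + 4 ≡ g
      n+4≡g = sym (trans (m≤n⇒m⊓n≡m (<⇒≤ (subst₂ (λ x y → x + 4 < y) n≡ fresh-slot far′))) (cong (_+ 4) (sym n≡)))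
      g<b : g < pos (suc p)
      g<b = subst₂ _<_ n+4≡g fresh-slot far′
      n<g : n < g
      n<g = subst (n <_) n+4≡g (m<m+n n (s≤s z≤n))
      1≤g : 1 ≤ g
      1≤g = ≤-<-trans z≤n n<g
      d = proj₁ (m≤n⇒∃[o]m+o≡n g<b)
      b≡ : suc (g + d) ≡ pos (suc p)
      b≡ = proj₂ (m≤n⇒∃[o]m+o≡n g<b)
      sd≡lag : suc d ≡ lag (suc p)
      sd≡lag = +-cancelˡ-≡ g (suc d) (lag (suc p)) (trans (+-suc g d) (trans b≡ (sym (slot+lag (suc p)))))
      cost : suc (3 + suc (d + suc (d + 1))) + 2 * total p ≤ 12 + 2 * total (suc p)
      cost = begin
        suc (3 + suc (d + suc (d + 1))) + 2 * total p  ≡⟨ solve 2 (λ x y → con 4 :+ (con 1 :+ (x :+ (con 1 :+ (x :+ con 1)))) :+ con 2 :* y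
                                                            := con 5 :+ con 2 :* (y :+ (con 1 :+ x))) refl d (total p) ⟩
        5 + 2 * (total p + suc d)                      ≤⟨ +-mono-≤ (m≤n+m 5 7) (*-monoʳ-≤ 2 (+-monoʳ-≤ (total p)
                                                            (≤-trans (≤-reflexive sd≡lag) (lag≤load (suc p))))) ⟩
        12 + 2 * total (suc p)                         ∎
        where
        open ≤-Reasoning
        open +-*-Solver

  tm-step : ∀ {p h t X q q′ a mv} → Inv p h t X → 1 ≤ p → h ≤ p → q ≢ acceptM → δM q (t h) ≡ (q′ , a , mv) →
    Stepped p (slots p h) q X q′ (moveℕ mv h) (update t h a)
  tm-step {h = zero}   {mv = L} I 1≤p h≤p q≢ e = step-L-origin I 1≤p h≤p q≢ e refl refl
  tm-step {h = suc h′} {mv = L} I 1≤p h≤p q≢ e = step-L I 1≤p h≤p q≢ e refl h′ refl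
  tm-step {mv = S} I 1≤p h≤p q≢ e = step-S I 1≤p h≤p q≢ e refl
  tm-step {mv = R} I 1≤p h≤p q≢ e = step-R I 1≤p h≤p q≢ e refl

  tm-run : ∀ n {p h t X q} → Inv p h t X → 1 ≤ p → h ≤ p →
    let c = tmRun M n (tmcfg q h t) in
    ∃[ p′ ] ∃[ X′ ] ∃[ k ] Run (exec q) (slots p h) X k (exec (TMConfig.state c)) (slots p′ (TMConfig.head c)) X′
      × Inv p′ (TMConfig.head c) (TMConfig.tape c) X′ × 1 ≤ p′ × TMConfig.head c ≤ p′ × p′ ≤ n + p
      × k + 2 * total p ≤ n * 12 + 2 * total p′
  tm-run zero {p} {X = X} I 1≤p h≤p = p , X , 0 , done , I , 1≤p , h≤p , ≤-refl , ≤-refl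
  tm-run (suc n) {p} {h} {t} {X} {q} I 1≤p h≤p with q ≟F acceptM
  ... | yes _ with tm-run n {q = q} I 1≤p h≤p
  ...   | p′ , X′ , k , r , I′ , 1≤p′ , h≤p′ , p′≤ , cost =
    p′ , X′ , k , r , I′ , 1≤p′ , h≤p′ , m≤n⇒m≤1+n p′≤ , ≤-trans cost (+-monoˡ-≤ (2 * total p′) (m≤n+m (n * 12) 12))
  tm-run (suc n) {p} {h} {t} {X} {q} I 1≤p h≤p | no q≢ with δM q (t h) in e
  ... | q₁ , a , mv with tm-step I 1≤p h≤p q≢ e
  ...   | p₁ , X₁ , k₁ , r₁ , I₁ , p≤p₁ , h≤p₁ , p₁≤ , cost₁ with tm-run n {q = q₁} I₁ (≤-trans 1≤p p≤p₁) h≤p₁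
  ...     | p′ , X′ , k , r , I′ , 1≤p′ , h≤p′ , p′≤ , cost =
    p′ , X′ , k₁ + k , run-trans r₁ r , I′ , 1≤p′ , h≤p′ ,
    ≤-trans p′≤ (≤-trans (+-monoʳ-≤ n p₁≤) (≤-reflexive (+-suc n p))) , total-cost
    where
    total-cost : k₁ + k + 2 * total p ≤ 12 + n * 12 + 2 * total p′
    total-cost = begin
      k₁ + k + 2 * total p           ≡⟨ solve 3 (λ x y z → x :+ y :+ z := y :+ (x :+ z)) refl k₁ k (2 * total p) ⟩
      k + (k₁ + 2 * total p)         ≤⟨ +-monoʳ-≤ k cost₁ ⟩
      k + (12 + 2 * total p₁)        ≡⟨ solve 2 (λ x y → x :+ (con 12 :+ y) := con 12 :+ (x :+ y)) refl k (2 * total p₁) ⟩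
      12 + (k + 2 * total p₁)        ≤⟨ +-monoʳ-≤ 12 cost ⟩
      12 + (n * 12 + 2 * total p′)   ≡⟨ sym (+-assoc 12 (n * 12) (2 * total p′)) ⟩
      12 + n * 12 + 2 * total p′     ∎
      where
      open ≤-Reasoning
      open +-*-Solver

  -- Returning the moved cells

  act-finR-plain : ∀ c v a → act (finR c) v (native plain a) ≡ (native plain a , left , finL)
  act-finR-plain fz     v a = refl
  act-finR-plain (fs c) v a = refl

  act-finR-used : ∀ c v x → x ≢ empty → (∀ a → x ≢ native plain a) → act (finR c) v x ≡ (x , right , finR three)
  act-finR-used c      v empty              ne _ = ⊥-elim (ne refl)
  act-finR-used c      v (native plain a)   _ np = ⊥-elim (np a refl)
  act-finR-used fz     v (guest _)          _ _  = refl
  act-finR-used fz     v (native visited _) _ _  = refl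
  act-finR-used fz     v (native first _)   _ _  = refl
  act-finR-used (fs c) v (guest _)          _ _  = refl
  act-finR-used (fs c) v (native visited _) _ _  = refl
  act-finR-used (fs c) v (native first _)   _ _  = refl

  rest-at : ∀ {p h t X} → Inv p h t X → ∀ z → Run finL (slots p z) X 1 rest (slots p z) X
  rest-at I z = stay (trans (cong (act finL _) (filled I z)) (act-filled-finL _ _ (nonempty I z))) (update-self (filled I z)) done

  -- To the right of the head every explored cell is non-plain and restarts the counter. The
  -- frontier is recognised either by a plain cell or by four empty steps, which cannot occur
  -- between explored cells. The 8 consists of three counted steps, up to four steps back, and the
  -- change to `rest`.
  find-frontier : ∀ {p h t X} → Inv p h t X → 1 ≤ p → ∀ d z → z + d ≡ p → h ≤ z →
    Run (finR three) (suc (slots p z)) X (d * 4 + 8) rest (slots p p) X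
  find-frontier {p} {X = X} I 1≤p zero z eq h≤z rewrite sym (trans (sym (+-identityʳ z)) eq)
    with slots z (suc z) ≤? slots z z + 4
  ... | yes near with approach I finR (λ _ _ → refl) z near
  ...   | c , r = run-trans r (run-trans (run-weaken gap (step-back I (λ _ → refl) z
      (trans (cong (act (finR c) (visit (tour (slots z (suc z))))) at-fresh) (act-finR-plain c (visit (tour (slots z (suc z)))) _))
      (trans (cong isFirst at-fresh) (sym (≢⇒≡ᵇ-false (suc z) 1 (λ e → <⇒≢ (s≤s 1≤p) (sym e)))))
      (update-self at-fresh))) (rest-at I z))
    where
    at-fresh : X (slots z (suc z)) ≡ native plain _
    at-fresh = trans (filled I (suc z)) (fresh I (suc z) (n<1+n z))
    gap : slots z (suc z) ∸ slots z z ≤ 4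
    gap = ≤-trans (∸-monoˡ-≤ (slots z z) near) (≤-reflexive (m+n∸m≡n (slots z z) 4))
  find-frontier {X = X} I 1≤p zero z eq h≤z | no far =
    run-trans (overrun I finR (λ _ _ → refl) z far′)
      (subst (λ i → Run (finR fz) i X 5 rest (slots z z) X) (sym (+-suc m 3))
        (left (cong (act (finR fz) _) vac)
          (trans (cong isFirst vac) (sym (≢⇒≡ᵇ-false (m + 3) 0 (m+1+n≢0 m))))
          (update-self vac)
          (run-trans (run-weaken (≤-reflexive (m+n∸m≡n m 3)) (walk-back I (λ _ → refl) z (m + 3) (m≤m+n m 3)
            (<-trans (+-monoʳ-< m (n<1+n 3)) far′))) (rest-at I z))))
    where
    m = slots z z
    far′ : m + 4 < slots z (suc z)
    far′ = ≰⇒> far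
    vac : X (suc (m + 3)) ≡ empty
    vac = vacant-between I z (suc (m + 3)) (s≤s (m≤m+n m 3)) (subst (_< slots z (suc z)) (+-suc m 3) far′)
  find-frontier {p} {X = X} I 1≤p (suc d) z eq h≤z with approach I finR (λ _ _ → refl) z (slots-gap z<p)
    where
    z<p : suc z ≤ p
    z<p = m+n≤o⇒m≤o (suc z) (≤-reflexive (trans (sym (+-suc z d)) eq))
  ... | c , r = run-trans r (right (trans (cong (act (finR c) _) (filled I (suc z)))
      (act-finR-used c _ _ (nonempty I (suc z)) (used I (suc z)
        (m+n≤o⇒m≤o (suc z) (≤-reflexive (trans (sym (+-suc z d)) eq))) (λ e → <⇒≢ (s≤s h≤z) (sym e)))))
    (update-self (filled I (suc z)))
    (find-frontier I 1≤p d (suc z) (trans (sym (+-suc z d)) eq) (m≤n⇒m≤1+n h≤z)))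

  -- Three conditions on `X₁` cover both a native cell, whose slot is its home, and a guest. Because
  -- slot and home may coincide, the slot has to be empty only when they differ.
  release : ∀ {p h t X X₁} → Inv (suc p) h t X → X₁ (pos (suc p)) ≡ native plain (t (suc p)) →
    (slot (suc p) ≢ pos (suc p) → X₁ (slot (suc p)) ≡ empty) →
    (∀ n → slot (suc p) ≢ n → pos (suc p) ≢ n → X₁ n ≡ X n) → Inv p h t X₁
  release {p} {h} {t} {X} {X₁} I at-b at-g outside = record
    { cell     = cell′
    ; filled   = filled′
    ; vacant   = vacant′
    ; contents = contents′
    ; nonempty = nonempty′
    ; fresh    = fresh′
    ; used     = λ z z≤p z≢ a e → used I z (m≤n⇒m≤1+n z≤p) z≢ a (trans (sym (other (<⇒≢ (s≤s z≤p) ∘ sym))) e)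
    ; isfirst  = λ z z≤p → trans (cong isFirst (other (<⇒≢ (s≤s z≤p) ∘ sym))) (isfirst I z (m≤n⇒m≤1+n z≤p))
    ; athome   = λ z z≤p k a e → athome I z (m≤n⇒m≤1+n z≤p) k a (trans (sym (other (<⇒≢ (s≤s z≤p) ∘ sym))) e)
    }
    where
    g = slot (suc p)
    b = pos (suc p)
    x = native plain (t (suc p))
    cell′ : ℕ → Status
    cell′ = update (cell I) (suc p) x
    same : cell′ (suc p) ≡ x
    same = update-same (cell I) (suc p) x
    other : ∀ {z} → suc p ≢ z → cell′ z ≡ cell I z
    other {z} = update-other (cell I) (suc p) x z
    to-b : slots p (suc p) ≡ b
    to-b = slots-fresh p (suc p) (n<1+n p)
    to-g : slots (suc p) (suc p) ≡ g
    to-g = slots-explored (suc p) (suc p) ≤-refl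
    filled′ : ∀ z → X₁ (slots p z) ≡ cell′ z
    filled′ z with suc p ≟ z
    ... | yes refl = trans (cong X₁ to-b) (trans at-b (sym same))
    ... | no ne = trans (outside (slots p z)
          (λ e → ne (slots-injective (suc p) (trans to-g (trans e (sym keep)))))
          (λ e → ne (slots-injective p (trans to-b e))))
        (trans (cong X (sym keep)) (trans (filled I z) (sym (other ne))))
      where
      keep : slots (suc p) z ≡ slots p z
      keep = slots-extend p z (ne ∘ sym)
    vacant′ : ∀ n → (∀ z → slots p z ≢ n) → X₁ n ≡ empty
    vacant′ n ne with g ≟ n
    ... | yes refl = at-g (λ e → ne (suc p) (trans to-b (sym e)))
    ... | no g≢n = trans (outside n g≢n (λ e → ne (suc p) (trans to-b e))) (vacant I n away)
      where
      away : ∀ z → slots (suc p) z ≢ n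
      away z e with suc p ≟ z
      ... | yes refl = g≢n (trans (sym to-g) e)
      ... | no z≢ = ne z (trans (sym (slots-extend p z (z≢ ∘ sym))) e)
    contents′ : ∀ z → content (cell′ z) ≡ t z
    contents′ z with suc p ≟ z
    ... | yes refl = cong content same
    ... | no ne = trans (cong content (other ne)) (contents I z)
    nonempty′ : ∀ z → cell′ z ≢ empty
    nonempty′ z e with suc p ≟ z
    ... | no ne = nonempty I z (trans (sym (other ne)) e)
    ... | yes refl with trans (sym same) e
    ...   | ()
    fresh′ : ∀ z → p < z → cell′ z ≡ native plain (t z)
    fresh′ z p<z with suc p ≟ z
    ... | yes refl = same
    ... | no ne = trans (other ne) (fresh I z (≤∧≢⇒< p<z ne))

  act-rest-native : ∀ v k a → v ≢ atOrigin → act rest v (native k a) ≡ (native plain a , left , finL)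
  act-rest-native atOrigin k a ne = ⊥-elim (ne refl)
  act-rest-native before   k a ne = refl
  act-rest-native within   k a ne = refl
  act-rest-native after    k a ne = refl

  act-rest-guest : ∀ v a → v ≢ atOrigin → act rest v (guest a) ≡ (empty , right , restR a)
  act-rest-guest atOrigin a ne = ⊥-elim (ne refl)
  act-rest-guest before   a ne = refl
  act-rest-guest within   a ne = refl
  act-rest-guest after    a ne = refl

  act-restL : ∀ v a → v ≢ within → act (restL a) v empty ≡ (empty , left , restL a)
  act-restL atOrigin a ne = refl
  act-restL before   a ne = refl
  act-restL within   a ne = ⊥-elim (ne refl)
  act-restL after    a ne = refl

  visit-pos : ∀ z → visit (tour (pos (suc z))) ≡ within
  visit-pos z = cong visit (tour-pos (suc z))

  positive-visit : ∀ {n} → 1 ≤ n → visit (tour n) ≢ atOrigin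
  positive-visit {suc n} _ = tour-visit≢origin n

  home-gap : ∀ p → pos (suc p) ∸ slot p ≤ 4 + lag (suc p)
  home-gap p = ≤-trans (∸-monoˡ-≤ (slot p) (gap-bound p)) (≤-reflexive
    (trans (cong (_∸ slot p) (+-assoc (slot p) 4 (lag (suc p)))) (m+n∸m≡n (slot p) (4 + lag (suc p)))))

  -- A native cell merely loses its flavour. For a guest the machine walks on to the next filled
  -- place, which is cell `suc (suc p)` at its home, and turns back: by `between-homes` the first
  -- in-order visit it meets is the wanted home. This overshoot costs `lag (suc (suc p))` twice; the
  -- way from the home to the slot of cell `p` costs `lag (suc p)`, each up to a constant.
  restore-cell : ∀ {p h t X} → Inv (suc p) h t X → ∃[ X₁ ] ∃[ k ]
    Run rest (slots (suc p) (suc p)) X k rest (slots p p) X₁ × Inv p h t X₁ ×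
    k ≤ 2 * lag (suc (suc p)) + lag (suc p) + 16
  restore-cell {p} {h} {t} {X} I = go (cell I (suc p)) refl
    where
    g = slot (suc p)
    b = pos (suc p)
    a = t (suc p)
    to-b : slots p (suc p) ≡ b
    to-b = slots-fresh p (suc p) (n<1+n p)
    to-g : slots (suc p) (suc p) ≡ g
    to-g = slots-explored (suc p) (suc p) ≤-refl
    to-p : slots p p ≡ slot p
    to-p = slots-explored p p ≤-refl
    1≤g : 1 ≤ g
    1≤g = ≤-<-trans z≤n (slot-suc p)
    lag₁ = lag (suc p)
    lag₂ = lag (suc (suc p))
    final-gap : slots p (suc p) ∸ slots p p ≤ 4 + lag₁
    final-gap = subst₂ (λ i j → i ∸ j ≤ 4 + lag₁) (sym to-b) (sym to-p) (home-gap p)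
    at-g : ∀ {x} → cell I (suc p) ≡ x → X g ≡ x
    at-g e = trans (cong X (sym to-g)) (trans (filled I (suc p)) e)
    go : ∀ x → cell I (suc p) ≡ x → ∃[ X₁ ] ∃[ k ]
      Run rest (slots (suc p) (suc p)) X k rest (slots p p) X₁ × Inv p h t X₁ × k ≤ 2 * lag₂ + lag₁ + 16
    go empty e = ⊥-elim (nonempty I (suc p) e)
    go (native f a′) e = X₁ , _ , run-trans
        (subst (λ i → Run rest i X (slots p (suc p) ∸ slots p p) finL (slots p p) X₁) (trans to-b (trans (sym g≡b) (sym to-g)))
          (step-back I₁ (λ _ → refl) p
            (trans (cong (act rest v) at-n) (act-rest-native v f a′ (positive-visit (slots-positive p p))))
            (trans (cong isFirst at-n) (trans (cong isFirst (sym e)) (isfirst I (suc p) ≤-refl)))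
            (λ m → cong (λ i → update X i (native plain a′) m) (trans g≡b (sym to-b)))))
        (rest-at I₁ p) , I₁ , ≤-trans (+-monoˡ-≤ 1 final-gap)
          (≤-trans (≤-reflexive (+-comm (4 + lag₁) 1)) (≤-trans (≤-reflexive (+-comm 5 lag₁)) (≤-trans (+-mono-≤ (m≤n+m lag₁ (2 * lag₂)) (m≤n+m 5 11)) ≤-refl)))
      where
      v = visit (tour (slots p (suc p)))
      g≡b : g ≡ b
      g≡b = athome I (suc p) ≤-refl f a′ e
      X₁ = update X g (native plain a′)
      at-n : X (slots p (suc p)) ≡ native f a′
      at-n = trans (cong X (trans to-b (sym g≡b))) (at-g e)
      a≡ : a′ ≡ a
      a≡ = trans (cong content (sym e)) (contents I (suc p))
      I₁ : Inv p h t X₁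
      I₁ = release I (trans (cong X₁ (sym g≡b)) (trans (update-same X g _) (cong (native plain) a≡)))
        (λ g≢b → ⊥-elim (g≢b g≡b)) (λ n g≢n _ → update-other X g _ n g≢n)
    go (guest a′) e = X₂ , steps ,
      subst (λ i → Run rest i X steps rest (slots p p) X₂) (sym to-g)
        (right (trans (cong (act rest (visit (tour g))) (at-g e)) (act-rest-guest (visit (tour g)) a′ (positive-visit 1≤g))) (λ _ → refl)
        (run-trans (walk-right (λ _ → refl) d (suc g) (λ i lo hi → vac₁ i lo (subst (i <_) top hi)))
        (left (trans (cong (act (restR a′) _) at-top) refl)
          (trans (cong isFirst at-top) (sym (≢⇒≡ᵇ-false (g + d) 0 (λ e → <⇒≢ (≤-trans 1≤g (m≤m+n g d)) (sym e)))))
          (update-self at-top)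
        (run-trans (subst (λ i → Run (restL a′) i X₁ (g + d ∸ b) (restL a′) b X₁) (m+[n∸m]≡n b≤)
          (walk-left (λ v → v ≢ within) (λ v → act-restL v a′) (g + d ∸ b) b
            (λ i lo hi → let hi′ = subst (i <_) top (s≤s (≤-trans hi (≤-reflexive (m+[n∸m]≡n b≤)))) in
              vac₁ i (≤-<-trans (slot≤pos (suc p)) lo) hi′ , between-homes (suc p) i lo hi′)
            (inj₂ (≤-trans 1≤g (slot≤pos (suc p))))))
        (run-trans (subst (λ i → Run (restL a′) i X₁ (slots p (suc p) ∸ slots p p) finL (slots p p) X₂) to-b
          (step-back I₂ (λ _ → refl) p
            (subst (λ i → act (restL a′) (visit (tour i)) (X₁ i) ≡ (native plain a′ , left , finL)) (sym to-b)
              (trans (cong₂ (act (restL a′)) (visit-pos p) at-b) refl))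
            (trans (cong (isFirst ∘ X₁) to-b) (trans (cong isFirst at-b) (trans (cong isFirst (sym e)) (isfirst I (suc p) ≤-refl))))
            (λ m → cong (λ i → update X₁ i (native plain a′) m) (sym to-b))))
        (rest-at I₂ p)))))) , I₂ , cost
      where
      X₁ = update X g empty
      X₂ = update X₁ b (native plain a′)
      a≡ : a′ ≡ a
      a≡ = trans (cong content (sym e)) (contents I (suc p))
      g<top : g < pos (suc (suc p))
      g<top = ≤-<-trans (slot≤pos (suc p)) (pos-suc (suc p))
      d = proj₁ (m≤n⇒∃[o]m+o≡n g<top)
      top : suc (g + d) ≡ pos (suc (suc p))
      top = proj₂ (m≤n⇒∃[o]m+o≡n g<top)
      to-top : slots (suc p) (suc (suc p)) ≡ pos (suc (suc p))
      to-top = slots-fresh (suc p) (suc (suc p)) (n<1+n (suc p))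
      b≤ : b ≤ g + d
      b≤ = ≤-pred (subst (b <_) (sym top) (pos-suc (suc p)))
      vac₁ : ∀ i → g < i → i < pos (suc (suc p)) → X₁ i ≡ empty
      vac₁ i lo hi = trans (update-other X g empty i (<⇒≢ lo))
        (vacant-between I (suc p) i (subst (_< i) (sym to-g) lo) (subst (i <_) (sym to-top) hi))
      at-top : X₁ (suc (g + d)) ≡ native plain (t (suc (suc p)))
      at-top = trans (update-other X g empty _ (<⇒≢ (s≤s (m≤m+n g d))))
        (trans (cong X (trans top (sym to-top))) (trans (filled I (suc (suc p))) (fresh I (suc (suc p)) (n<1+n (suc p)))))
      at-b : X₁ b ≡ empty
      at-b with g ≟ b
      ... | yes g≡b = trans (cong X₁ (sym g≡b)) (update-same X g empty)
      ... | no g≢b = vac₁ b (≤∧≢⇒< (slot≤pos (suc p)) g≢b) (pos-suc (suc p))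
      I₂ : Inv p h t X₂
      I₂ = release I (trans (update-same X₁ b _) (cong (native plain) a≡))
        (λ g≢b → trans (update-other X₁ b _ g (g≢b ∘ sym)) (update-same X g empty))
        (λ n g≢n b≢n → trans (update-other X₁ b _ n b≢n) (update-other X g empty n g≢n))
      d≤ : d ≤ 3 + lag₂
      d≤ = +-cancelˡ-≤ (suc g) d (3 + lag₂) (≤-trans (≤-reflexive top) (≤-trans (gap-bound (suc p)) (≤-reflexive
        (trans (+-assoc g 4 lag₂) (+-suc g (3 + lag₂))))))
      steps = suc (d + suc (g + d ∸ b + (slots p (suc p) ∸ slots p p + 1)))
      cost : steps ≤ 2 * lag₂ + lag₁ + 16
      cost = begin
        suc (d + suc (g + d ∸ b + (slots p (suc p) ∸ slots p p + 1)))
          ≤⟨ s≤s (+-mono-≤ d≤ (s≤s (+-mono-≤ (≤-trans (∸-monoʳ-≤ (g + d) (slot≤pos (suc p))) (≤-trans (≤-reflexive (m+n∸m≡n g d)) d≤))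
               (+-monoˡ-≤ 1 final-gap)))) ⟩
        suc (3 + lag₂ + suc (3 + lag₂ + (4 + lag₁ + 1)))
          ≡⟨ solve 2 (λ x y → con 1 :+ (con 3 :+ x :+ (con 1 :+ (con 3 :+ x :+ (con 4 :+ y :+ con 1)))) := con 2 :* x :+ y :+ con 13) refl lag₂ lag₁ ⟩
        2 * lag₂ + lag₁ + 13 ≤⟨ +-monoʳ-≤ (2 * lag₂ + lag₁) (m≤n+m 13 3) ⟩
        2 * lag₂ + lag₁ + 16 ∎
        where
        open ≤-Reasoning
        open +-*-Solver

  restore : ∀ p {h t X} → Inv p h t X → ∃[ X₁ ] ∃[ k ]
    Run rest (slots p p) X k rest 0 X₁ × Inv 0 h t X₁ × k ≤ 2 * total (suc p) + total p + 16 * p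
  -- The overshoots for cells 1 to `p` are charged to cells 2 to `suc p`, whence `total (suc p)` in
  -- the bound.
  restore zero I = _ , 0 , done , I , z≤n
  restore (suc p) I with restore-cell I
  ... | X₁ , k₁ , r₁ , I₁ , k₁≤ with restore p I₁
  ...   | X₂ , k₂ , r₂ , I₂ , k₂≤ = X₂ , k₁ + k₂ , run-trans r₁ r₂ , I₂ , (begin
    k₁ + k₂                                     ≤⟨ +-mono-≤ k₁≤ k₂≤ ⟩
    2 * lag (suc (suc p)) + lag (suc p) + 16 + (2 * total (suc p) + total p + 16 * p)
      ≤⟨ +-monoˡ-≤ _ (+-monoˡ-≤ 16 (+-mono-≤ (*-monoʳ-≤ 2 (lag≤load (suc (suc p)))) (lag≤load (suc p)))) ⟩
    2 * load (suc (suc p)) + load (suc p) + 16 + (2 * total (suc p) + total p + 16 * p)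
      ≡⟨ solve 5 (λ x y u v q → con 2 :* x :+ y :+ con 16 :+ (con 2 :* u :+ v :+ con 16 :* q)
           := con 2 :* (u :+ x) :+ (v :+ y) :+ con 16 :* (con 1 :+ q)) refl (load (suc (suc p))) (load (suc p)) (total (suc p)) (total p) p ⟩
    2 * total (suc (suc p)) + total (suc p) + 16 * suc p ∎)
    where
    open ≤-Reasoning
    open +-*-Solver

  -- Initial and final tapes

  plainCell : Γ → Cell
  plainCell a = native plain a , empty , empty

  encode-input : ∀ x v → inputTape x v ≡ encodeCell (plainCell (inputTape x v))
  encode-input []      v       = refl
  encode-input (a ∷ x) zero    = refl
  encode-input (a ∷ x) (suc v) = encode-input x v

  initialCells : List (Fin s) → ℕ → Cell
  initialCells x = update (plainCell ∘ inputTape x) 1 (native first (inputTape x 1) , empty , empty)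

  initialCells-outer : ∀ x t v → t ≡ before ⊎ t ≡ after → get t (initialCells x v) ≡ empty
  initialCells-outer x t v o with 1 ≡ᵇ v
  initialCells-outer x t v (inj₁ refl) | true  = refl
  initialCells-outer x t v (inj₂ refl) | true  = refl
  initialCells-outer x t v (inj₁ refl) | false = refl
  initialCells-outer x t v (inj₂ refl) | false = refl

  initialStore : List (Fin s) → Store
  initialStore x n = get (visit (tour n)) (initialCells x (location (tour n)))

  initialise : ∀ x → ∃[ c ] Reach (tlmInit P x) 6 c × Here (exec startM) 0 (initialStore x) c
  initialise x with arrive {exec startM} {0} (origin []) ρ
    where
    y = encodeCell (native first (inputTape x 1) , empty , empty)
    ext = update (inputTape x) 1 y
    ext-cells : ∀ v → ext v ≡ encodeCell (initialCells x v)
    ext-cells v with 1 ≡ᵇ v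
    ... | true  = refl
    ... | false = encode-input x v
    ρ : Represents ext (initialStore x)
    ρ = represents (initialCells x) ext-cells (λ _ → refl) (λ t v o → inj₁ (initialCells-outer x t v o))
  ... | c , r , H = c ,
    tick-to (λ ()) refl refl refl refl (read-step (λ ()) refl
      (tick-to (λ ()) refl refl (cong marked decoded) refl (write-step (λ ()) refl
        (tick-to (λ ()) refl refl refl refl r)))) , H
    where
    decoded : decodeCell (inputTape x 1) ≡ plainCell (inputTape x 1)
    decoded = trans (cong decodeCell (encode-input x 1)) (decode-encodeCell (plainCell (inputTape x 1)))
    marked : Cell → Output
    marked c = (init₃ , exec startM) , set within (mark (get within c)) c , a1 , S

  initial-slots : ∀ z → slots 1 z ≡ pos z
  initial-slots zero          = refl
  initial-slots (suc zero)    = refl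
  initial-slots (suc (suc z)) = slots-fresh 1 (suc (suc z)) (s≤s (s≤s z≤n))

  tour-inn : ∀ {n j w} → tour n ≡ inn j w → n ≡ pos (node j w)
  tour-inn {n} {j} {w} e = tour-injective n (pos (node j w))
    (trans e (sym (trans (tour-pos (node j w)) (home-node j w (node j w) refl))))

  get-home : ∀ z c → get (visit (home z)) c ≡ proj₁ c
  get-home zero    c = refl
  get-home (suc z) c = refl

  get-pos : ∀ (C : ℕ → Cell) z → get (visit (tour (pos z))) (C (location (tour (pos z)))) ≡ proj₁ (C z)
  get-pos C z = trans (cong (λ p → get (visit p) (C (location p))) (tour-pos z))
    (trans (get-home z (C (location (home z)))) (cong (proj₁ ∘ C) (location-home z)))

  -- The frontier starts at 1 because the flag makes cell 1 non-plain, whereas `fresh` demands plain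
  -- cells beyond the frontier. Cell 0 is still plain, but it is the head cell.
  initial-inv : ∀ x → Inv 1 0 (inputTape x) (initialStore x)
  initial-inv x = record
    { cell     = proj₁ ∘ initialCells x
    ; filled   = λ z → trans (cong (initialStore x) (initial-slots z)) (get-pos (initialCells x) z)
    ; vacant   = vacant′
    ; contents = contents′
    ; nonempty = nonempty′
    ; fresh    = λ z 1<z → cong proj₁ (update-other (plainCell ∘ inputTape x) 1 _ z (<⇒≢ 1<z))
    ; used     = used′
    ; isfirst  = isfirst′
    ; athome   = athome′
    }
    where
    vacant′ : ∀ n → (∀ z → slots 1 z ≢ n) → initialStore x n ≡ empty
    vacant′ n ne with tour n in e
    ... | origin   = ⊥-elim (ne 0 (tour-injective 0 n (sym e)))
    ... | pre j w  = initialCells-outer x before (location (pre j w)) (inj₁ refl)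
    ... | inn j w  = ⊥-elim (ne (node j w) (trans (initial-slots (node j w)) (sym (tour-inn e))))
    ... | post j w = initialCells-outer x after (location (post j w)) (inj₂ refl)
    contents′ : ∀ z → content (proj₁ (initialCells x z)) ≡ inputTape x z
    contents′ zero          = refl
    contents′ (suc zero)    = refl
    contents′ (suc (suc z)) = refl
    nonempty′ : ∀ z → proj₁ (initialCells x z) ≢ empty
    nonempty′ zero          ()
    nonempty′ (suc zero)    ()
    nonempty′ (suc (suc z)) ()
    used′ : ∀ z → z ≤ 1 → z ≢ 0 → ∀ a → proj₁ (initialCells x z) ≢ native plain a
    used′ zero z≤1 ne a = ⊥-elim (ne refl)
    used′ (suc zero) z≤1 ne a ()
    used′ (suc (suc z)) (s≤s ())
    isfirst′ : ∀ z → z ≤ 1 → isFirst (proj₁ (initialCells x z)) ≡ (z ≡ᵇ 1)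
    isfirst′ zero          _ = refl
    isfirst′ (suc zero)    _ = refl
    isfirst′ (suc (suc z)) _ = refl
    athome′ : ∀ z → z ≤ 1 → ∀ k a → proj₁ (initialCells x z) ≡ native k a → slot z ≡ pos z
    athome′ zero          _ _ _ _ = refl
    athome′ (suc zero)    _ _ _ _ = refl
    athome′ (suc (suc z)) (s≤s ())

  holds-encoded : ∀ {t ext} → (∀ z → ext z ≡ encodeCell (plainCell (t z))) → ∀ y k → HoldsAt t k y → HoldsAt ext k y
  holds-encoded e []      k h       = trans (e k) (cong (encodeCell ∘ plainCell) h)
  holds-encoded e (a ∷ y) k (h , r) = trans (e k) (cong (encodeCell ∘ plainCell) h) , holds-encoded e y (suc k) r

  -- With frontier 0 every filled place is a home, so outer tracks on the tour are vacant; the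
  -- others are empty by `off-tour`. The last action has removed the flavour of cell 0, the only one
  -- that `fresh` leaves open.
  restored : ∀ {h t X ext} → Inv 0 h t X → Represents ext (update X 0 (native plain (content (X 0)))) →
    ∀ z → ext z ≡ encodeCell (plainCell (t z))
  restored {h} {t} {X} {ext} I ρ z = trans (ext-cells z) (cong encodeCell
    (cong₂ _,_ inner (cong₂ _,_ (outer before (inj₁ refl)) (outer after (inj₂ refl)))))
    where
    open Represents ρ
    X′ = update X 0 (native plain (content (X 0)))
    at-home : ∀ z → X′ (pos z) ≡ native plain (t z)
    at-home zero    = cong (native plain) (trans (cong content (filled I 0)) (contents I 0))
    at-home (suc z) = trans (update-other X 0 _ (pos (suc z)) (<⇒≢ (≤-<-trans z≤n (pos-suc z))))
      (trans (cong X (sym (slots-fresh 0 (suc z) (s≤s z≤n)))) (trans (filled I (suc z)) (fresh I (suc z) (s≤s z≤n))))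
    inner : proj₁ (cells z) ≡ native plain (t z)
    inner = trans (sym (get-pos cells z)) (trans (on-tour (pos z)) (at-home z))
    outer : ∀ v → v ≡ before ⊎ v ≡ after → get v (cells z) ≡ empty
    outer v o with off-tour v z o
    ... | inj₁ e = e
    ... | inj₂ (n , refl , refl) = trans (on-tour n) (trans (update-other X 0 _ n not-origin) (vacant I n away))
      where
      outer≢ : ∀ {v′} → visit (tour n) ≡ v′ → v′ ≢ before → v′ ≢ after → ⊥
      outer≢ e b a = [ (λ e′ → b (trans (sym e) e′)) , (λ e′ → a (trans (sym e) e′)) ]′ o
      not-origin : 0 ≢ n
      not-origin e = outer≢ (cong (visit ∘ tour) (sym e)) (λ ()) (λ ())
      away : ∀ z → slots 0 z ≢ n
      away zero    e = not-origin (trans (sym (slots-origin 0)) e)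
      away (suc z) e = outer≢ (trans (cong (visit ∘ tour) (trans (sym e) (slots-fresh 0 (suc z) (s≤s z≤n)))) (visit-pos z))
        (λ ()) (λ ())

  -- Time and IO counts

  tlmRun-tick : ∀ c c′ k → tlmStep P c ≡ (c′ , tick) →
    tlmRun P (suc k) c ≡ (let d , t , i = tlmRun P k c′ in d , suc t , i)
  tlmRun-tick c c′ k e rewrite e = refl

  tlmRun-io : ∀ c c′ k → tlmStep P c ≡ (c′ , io) →
    tlmRun P (suc k) c ≡ (let d , t , i = tlmRun P k c′ in d , t , suc i)
  tlmRun-io c c′ k e rewrite e = refl

  reach-run : ∀ {c n c′} → Reach c n c′ →
    ∃[ k ] proj₁ (tlmRun P k c) ≡ c′ × proj₁ (proj₂ (tlmRun P k c)) ≤ n × proj₂ (proj₂ (tlmRun P k c)) ≤ n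
  reach-run done = 0 , refl , z≤n , z≤n
  reach-run (step {c = c} {c₁} {k = halted} ne e r) = ⊥-elim (ne refl)
  reach-run (step {c = c} {c₁} {k = tick} ne e r) with reach-run r
  ... | k , d , t≤ , i≤ = suc k , trans (cong proj₁ (tlmRun-tick c c₁ k e)) d ,
    ≤-trans (≤-reflexive (cong (proj₁ ∘ proj₂) (tlmRun-tick c c₁ k e))) (s≤s t≤) ,
    ≤-trans (≤-reflexive (cong (proj₂ ∘ proj₂) (tlmRun-tick c c₁ k e))) (m≤n⇒m≤1+n i≤)
  reach-run (step {c = c} {c₁} {k = io} ne e r) with reach-run r
  ... | k , d , t≤ , i≤ = suc k , trans (cong proj₁ (tlmRun-io c c₁ k e)) d ,
    ≤-trans (≤-reflexive (cong (proj₁ ∘ proj₂) (tlmRun-io c c₁ k e))) (m≤n⇒m≤1+n t≤) ,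
    ≤-trans (≤-reflexive (cong (proj₂ ∘ proj₂) (tlmRun-io c c₁ k e))) (s≤s i≤)

  exec-accept : ∀ {q} v x → q ≡ acceptM → act (exec q) v x ≡ (x , right , finR three)
  exec-accept {q} v x e with q ≟F acceptM
  ... | yes _ = refl
  ... | no ne = ⊥-elim (ne e)

  -- Replacing each `total` by its linear bound gives `12 * n + 170 * p + 159`. With `p ≤ n + 1`
  -- this is at most `182 * n + 329`, and `1 ≤ n` absorbs the constant.
  action-count : ∀ n p k d k₃ → 1 ≤ n → p ≤ n + 1 → d ≤ p → k + 2 * total 1 ≤ n * 12 + 2 * total p →
    k₃ ≤ 2 * total (suc p) + total p + 16 * p → k + (suc (d * 4 + 8) + k₃) ≤ 511 * n
  action-count n p k d k₃ 1≤n p≤ d≤ k≤ k₃≤ = begin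
    k + (suc (d * 4 + 8) + k₃)
      ≤⟨ +-mono-≤ (≤-trans (m≤m+n k (2 * total 1)) k≤) (+-mono-≤ (s≤s (+-monoˡ-≤ 8 (*-monoˡ-≤ 4 d≤))) k₃≤) ⟩
    n * 12 + 2 * total p + (suc (p * 4 + 8) + (2 * total (suc p) + total p + 16 * p))
      ≤⟨ +-mono-≤ (+-monoʳ-≤ (n * 12) (*-monoʳ-≤ 2 below)) (+-monoʳ-≤ (suc (p * 4 + 8))
           (+-monoˡ-≤ (16 * p) (+-mono-≤ (*-monoʳ-≤ 2 (total-linear p)) below))) ⟩
    n * 12 + 2 * (30 * suc p) + (suc (p * 4 + 8) + (2 * (30 * suc p) + 30 * suc p + 16 * p))
      ≡⟨ solve 2 (λ x y → x :* con 12 :+ con 2 :* (con 30 :* (con 1 :+ y)) :+ (con 1 :+ (y :* con 4 :+ con 8) :+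
            (con 2 :* (con 30 :* (con 1 :+ y)) :+ con 30 :* (con 1 :+ y) :+ con 16 :* y))
          := con 12 :* x :+ con 170 :* y :+ con 159) refl n p ⟩
    12 * n + 170 * p + 159          ≤⟨ +-monoˡ-≤ 159 (+-monoʳ-≤ (12 * n) (*-monoʳ-≤ 170 p≤)) ⟩
    12 * n + 170 * (n + 1) + 159    ≡⟨ solve 1 (λ x → con 12 :* x :+ con 170 :* (x :+ con 1) :+ con 159
                                          := con 182 :* x :+ con 329 :* con 1) refl n ⟩
    182 * n + 329 * 1               ≤⟨ +-monoʳ-≤ (182 * n) (*-monoʳ-≤ 329 1≤n) ⟩
    182 * n + 329 * n               ≡⟨ sym (*-distribʳ-+ n 182 329) ⟩
    511 * n                         ∎
    where
    open ≤-Reasoning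
    open +-*-Solver
    below : total p ≤ 30 * suc p
    below = ≤-trans (m≤m+n (total p) _) (total-linear p)

  abstract
    steps-per-time : ℕ
    steps-per-time = 511 * 8 + 8

    -- Six steps set the flag and reach cell 0, each action takes at most eight, and the last one
    -- takes two because it halts without moving.
    step-count : ∀ K n → 1 ≤ n → K ≤ 511 * n → 6 + (K * 8 + 2) ≤ steps-per-time * n
    step-count K n 1≤n K≤ = begin
      6 + (K * 8 + 2)          ≡⟨ solve 1 (λ x → con 6 :+ (x :* con 8 :+ con 2) := x :* con 8 :+ con 8 :* con 1) refl K ⟩
      K * 8 + 8 * 1            ≤⟨ +-mono-≤ (*-monoˡ-≤ 8 K≤) (*-monoʳ-≤ 8 1≤n) ⟩
      511 * n * 8 + 8 * n      ≡⟨ cong (_+ 8 * n) (trans (*-assoc 511 n 8) (trans (cong (511 *_) (*-comm n 8)) (sym (*-assoc 511 8 n)))) ⟩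
      511 * 8 * n + 8 * n      ≡⟨ sym (*-distribʳ-+ n (511 * 8) 8) ⟩
      steps-per-time * n       ∎
      where
      open ≤-Reasoning
      open +-*-Solver

  computes : ∀ x y n → 1 ≤ n → TMConfig.state (tmRun M n (tmInit M x)) ≡ acceptM →
    HoldsAt (TMConfig.tape (tmRun M n (tmInit M x))) 0 y → ∃[ c ]
      Reach (tlmInit P x) (steps-per-time * n) c × TLMConfig.state c ≡ TLM.accept P × HoldsAt (TLMConfig.ext c) 0 y
  computes x y n 1≤n accepting holds
    with initialise x | tm-run n {q = startM} (initial-inv x) (s≤s z≤n) z≤n
  ... | c₀ , r₀ , H₀ | p , X , k , run , I , 1≤p , h≤p , p≤ , k≤
    with m≤n⇒∃[o]m+o≡n h≤p | restore p I
  ... | d , h+d≡p | X₁ , k₃ , run₃ , I₃ , k₃≤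
    with simulate (run-trans run (run-trans
           (right (exec-accept _ _ accepting) (update-self refl) (find-frontier I 1≤p d _ h+d≡p ≤-refl)) run₃)) H₀
  ... | c₁ , r₁ , H₁ with act-stop H₁ refl (λ _ → refl)
  ...   | _ , r₂ , halted ρ = _ ,
    reach-weaken (step-count (k + (suc (d * 4 + 8) + k₃)) n 1≤n
      (action-count n p k d k₃ 1≤n p≤ (m+n≤o⇒n≤o _ (≤-reflexive h+d≡p)) k≤ k₃≤))
      (reach-trans r₀ (reach-trans r₁ r₂)) , refl , holds-encoded (restored I₃ ρ) y 0 holds

  tmRun-accepting : ∀ n {q h t} → q ≡ acceptM → tmRun M n (tmcfg q h t) ≡ tmcfg q h t
  tmRun-accepting zero    e = refl
  tmRun-accepting (suc n) {q} e with q ≟F acceptM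
  ... | yes _ = tmRun-accepting n e
  ... | no ne = ⊥-elim (ne e)

  haltingTLM : TLM s 0
  haltingTLM = record
    { e = eM ; nQ = 1 ; kind = λ _ → ordinary ; δ = λ q x b → q , x , S , b , S
    ; ioNext = λ q → q , S ; start = fz ; accept = fz }

  reach-outcome : ∀ {c n c′} y → Reach c n c′ → TLMConfig.state c′ ≡ TLM.accept P → HoldsAt (TLMConfig.ext c′) 0 y → ∃[ k ]
    ( TLMConfig.state (proj₁ (tlmRun P k c)) ≡ TLM.accept P
    × HoldsAt (TLMConfig.ext (proj₁ (tlmRun P k c))) zero y
    × proj₁ (proj₂ (tlmRun P k c)) ≤ n × proj₂ (proj₂ (tlmRun P k c)) ≤ n)
  reach-outcome y r acc holds = let k , e , t≤ , i≤ = reach-run r in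
    k , trans (cong TLMConfig.state e) acc , subst (λ c → HoldsAt (TLMConfig.ext c) zero y) (sym e) holds , t≤ , i≤

  halted-simulation : ∀ f T → startM ≡ acceptM → TMComputesInTime M f T → TLMComputesIn haltingTLM f T T
  halted-simulation f T e (c , N , run) = 0 , 0 , λ x → 0 , refl , unchanged x , λ _ → z≤n , z≤n
    where
    unchanged : ∀ x → HoldsAt (inputTape {s} {eM} x) zero (f x)
    unchanged x = subst (λ d → HoldsAt (TMConfig.tape d) 0 (f x)) (tmRun-accepting (proj₁ (run x)) e)
      (proj₁ (proj₂ (proj₂ (run x))))

  running-simulation : ∀ f T → startM ≢ acceptM → TMComputesInTime M f T → TLMComputesIn P f T T
  running-simulation f T ne (c , N , run) = steps-per-time * c , N , λ x → bounded x (run x)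
    where
    scaled : ∀ x {n m} → n ≤ c * T (length x) → m ≤ steps-per-time * n → m ≤ steps-per-time * c * T (length x)
    scaled x n≤ m≤ = ≤-trans m≤ (≤-trans (*-monoʳ-≤ steps-per-time n≤)
      (≤-reflexive (sym (*-assoc steps-per-time c (T (length x))))))
    bounded : ∀ x → ∃[ n ]
      ( TMConfig.state (tmRun M n (tmInit M x)) ≡ acceptM
      × HoldsAt (TMConfig.tape (tmRun M n (tmInit M x))) zero (f x)
      × (N ≤ length x → n ≤ c * T (length x))) → ∃[ k ]
      ( TLMConfig.state (proj₁ (tlmRun P k (tlmInit P x))) ≡ TLM.accept P
      × HoldsAt (TLMConfig.ext (proj₁ (tlmRun P k (tlmInit P x)))) zero (f x)
      × (N ≤ length x → proj₁ (proj₂ (tlmRun P k (tlmInit P x))) ≤ steps-per-time * c * T (length x)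
                      × proj₂ (proj₂ (tlmRun P k (tlmInit P x))) ≤ steps-per-time * c * T (length x)))
    -- Running time 0 would make the start state accept. Hence `1 ≤ n`, and the additive overhead
    -- becomes a multiple of the running time.
    bounded x (zero , accepting , _) = ⊥-elim (ne accepting)
    bounded x (suc n , accepting , holds , n≤) =
      let d , r , acc , holds′ = computes x (f x) (suc n) (s≤s z≤n) accepting holds
          k , acc′ , holds″ , t≤ , i≤ = reach-outcome (f x) r acc holds′
      in k , acc′ , holds″ , λ N≤ → scaled x (n≤ N≤) t≤ , scaled x (n≤ N≤) i≤

theorem1 : (s : ℕ) (f : List (Fin s) → List (Fin s)) (T : ℕ → ℕ) →
    (∃[ M ] TMComputesInTime {s} M f T) →
    ∃[ m ] ∃[ P ] TLMComputesIn {s} {m} P f T T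
theorem1 s f T (M , computed) with TM.start M ≟F TM.accept M
... | yes e = 0 , Simulation.haltingTLM M , Simulation.halted-simulation M f T e computed
... | no ne = 0 , Simulation.P M , Simulation.running-simulation M f T ne computed
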